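{- Let $n \ge 7$ and let $M \in \mathcal{S}_n$ be a singular maximizer of $C_3$. Then $M$ is nontrivial if and only if $M$ is strongly connected.
   Context: A tournament of order $n$ is an orientation of the complete graph on $n$ vertices; a tournament matrix of order $n$ is its adjacency matrix, i.e. an $n \times n$ $(0,1)$-matrix $M$ with $M + M^T = J_n - I_n$ ($J_n$ all-ones, $I_n$ identity). Tournaments and their matrices are identified. $\mathcal{S}_n$ is the set of singular tournament matrices of order $n$ (over the real/complex numbers). $C_3(M)$ is the number of directed $3$-cycles of $M$, counted as $3$-vertex subsets inducing a directed cycle. A matrix $M \in \mathcal{S}_n$ is a singular maximizer of $C_3$ if $C_3(M) = \max_{N \in \mathcal{S}_n} C_3(N)$. A singular maximizer of $C_3$ of order $n$ is called trivial if it is obtained by adding a vertex (with arbitrary arcs between the new vertex and the old ones) to a regular or almost regular tournament of order $n-1$, and nontrivial otherwise. A tournament is regular if all its vertices have the same outdegree; it is almost regular if the maximum difference of outdegrees between its vertices is $1$ (its order is then even). A tournament is strongly connected if for every pair of vertices there is a directed walk from each to the other. -}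

module Defs where

open import Data.Bool.Base using (if_then_else_)
open import Data.Fin.Base using (Fin; zero; suc; toℕ; punchIn; _<_)
open import Data.Fin.Properties using (_≟_; _<?_)
open import Data.Integer.Base using (ℤ; 0ℤ; 1ℤ; -1ℤ; _+_; _-_; _*_; _^_)
import Data.Integer.Properties as ℤ
open import Data.List.Base using (List; length; filter; allFin; cartesianProduct)
open import Data.Nat.Base as ℕ using (ℕ; zero; suc)
open import Data.Product.Base using (_×_; _,_; ∃-syntax)
open import Data.Sum.Base using (_⊎_)
open import Data.Vec.Functional using (Vector; transpose)
open import Relation.Binary.Construct.Closure.ReflexiveTransitive using (Star)
open import Relation.Binary.PropositionalEquality.Core using (_≡_)
open import Relation.Nullary.Decidable using (Dec; does; _×-dec_; _⊎-dec_)
open import Relation.Nullary.Negation using (¬_)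

open import Algebra.Properties.CommutativeMonoid.Sum ℤ.+-0-commutativeMonoid using (sum-syntax)

Matrix : ℕ → Set
Matrix n = Vector (Vector ℤ n) n

J I : ∀ n → Matrix n
J n i j = 1ℤ
I n i j = if does (i ≟ j) then 1ℤ else 0ℤ

minor : ∀ {n} → Matrix (suc n) → Fin (suc n) → Fin (suc n) → Matrix n
minor A r c i j = A (punchIn r i) (punchIn c j)

-- Laplace expansion along the first row.
det : ∀ {n} → Matrix n → ℤ
det {zero}  A = 1ℤ
det {suc n} A = ∑[ j < suc n ] ((-1ℤ ^ toℕ j) * A zero j * det (minor A zero j))

record Tournament (n : ℕ) : Set where
  field
    matrix   : Matrix n
    zero-one : ∀ i j → matrix i j ≡ 0ℤ ⊎ matrix i j ≡ 1ℤ
    M+Mᵀ≡J-I : ∀ i j → matrix i j + transpose matrix i j ≡ J n i j - I n i j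

open Tournament public

-- The determinant of an integer matrix does not depend on whether it is
-- computed over ℤ, ℝ or ℂ, so this is singularity over the reals.
Singular : ∀ {n} → Tournament n → Set
Singular M = det (matrix M) ≡ 0ℤ

triples : ∀ n → List (Fin n × Fin n × Fin n)
triples n = cartesianProduct (allFin n) (cartesianProduct (allFin n) (allFin n))

module _ {n : ℕ} (M : Tournament n) where

  Arc : Fin n → Fin n → Set
  Arc i j = matrix M i j ≡ 1ℤ

  arc? : ∀ i j → Dec (Arc i j)
  arc? i j = matrix M i j ℤ.≟ 1ℤ

  outdegree : Fin n → ℕ
  outdegree i = length (filter (arc? i) (allFin n))

  Regular : Set
  Regular = ∀ i j → outdegree i ≡ outdegree j

  AlmostRegular : Set
  AlmostRegular = (∀ i j → outdegree i ℕ.≤ suc (outdegree j))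
                × (∃[ i ] ∃[ j ] outdegree i ≡ suc (outdegree j))

  StronglyConnected : Set
  StronglyConnected = ∀ i j → Star Arc i j

  -- A 3-vertex subset {i, j, k} is represented by its increasing
  -- enumeration i < j < k; it induces a directed cycle in one of the two
  -- possible directions.
  CyclicTriple : Fin n × Fin n × Fin n → Set
  CyclicTriple (i , j , k) =
    (i < j × j < k) ×
    ((Arc i j × Arc j k × Arc k i) ⊎ (Arc i k × Arc k j × Arc j i))

  cyclicTriple? : ∀ t → Dec (CyclicTriple t)
  cyclicTriple? (i , j , k) =
    ((i <? j) ×-dec (j <? k)) ×-dec
    ((arc? i j ×-dec arc? j k ×-dec arc? k i) ⊎-dec
     (arc? i k ×-dec arc? k j ×-dec arc? j i))

  C₃ : ℕ
  C₃ = length (filter cyclicTriple? (triples n))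

SingularMaximizer : ∀ {n} → Tournament n → Set
SingularMaximizer {n} M =
  Singular M × (∀ (N : Tournament n) → Singular N → C₃ N ℕ.≤ C₃ M)

-- M arises from N by adding the vertex v; nothing is required of the arcs
-- between v and the vertices of N.
AddsVertex : ∀ {m} → Tournament m → Tournament (suc m) → Set
AddsVertex N M =
  ∃[ v ] (∀ i j → matrix M (punchIn v i) (punchIn v j) ≡ matrix N i j)

data Trivial : ∀ {n} → Tournament n → Set where
  trivial : ∀ {m} {M : Tournament (suc m)} (N : Tournament m) →
            Regular N ⊎ AlmostRegular N → AddsVertex N M → Trivial M

Nontrivial : ∀ {n} → Tournament n → Set
Nontrivial M = ¬ Trivial M

{-# OPTIONS --safe #-}
module Submission where

-- Let d(i) be the outdegree minus the indegree of i and D = ∑ d(i)².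
-- Moon's identity says that 8 C₃ + D depends on n only, so maximizing C₃ means
-- minimizing D.  If M z = 0 with z ≠ 0, then M + Mᵀ = J - I gives
-- ∑ z² = (∑ z)² and ∑ d z = (n - 1) ∑ z, whence D ≥ (n - 1)² by Cauchy–Schwarz.
-- * If v is added to an (almost) regular tournament of order m = n - 1 ≥ 5 and
--   has both in- and out-neighbours, then D < m², so the result is nonsingular.
--   Hence v is a source or a sink and M is not strongly connected.
-- * If M is not strongly connected, it has a cut into parts of sizes a, b with
--   all arcs in one direction, and D ≥ n a b.  Adding a sink to an (almost)
--   regular tournament yields a singular tournament with D ≤ n² - 1, so a
--   maximizer has a = 1 or b = 1, and the other part minimizes D in its order.

open import Defs
open import Data.Bool.Base using (Bool; true; false; not; _∧_; _∨_)
open import Data.Fin.Base using (Fin; zero; suc; toℕ; punchIn; punchOut; pinch)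
open import Data.Fin.Properties using (_≟_; _<?_; <⇒≢; <-trans; all?; any?; ¬∀⟶∃¬; punchIn-injective; punchIn-punchOut; punchInᵢ≢i)
open import Data.Fin.Subset as Subset using (Subset; _∈_; _∪_; ⁅_⁆)
import Data.Fin.Subset.Properties as Subset
open import Data.Integer.Base using (ℤ; +_; -[1+_]; 0ℤ; 1ℤ; -1ℤ; _+_; _-_; _*_; -_; _^_; ∣_∣; _≤_; _<_; +≤+; -≤+; -≤-; +<+)
import Data.Integer.Properties as ℤ
open import Data.Integer.Tactic.RingSolver using (solve-∀)
open import Data.List.Base as List using (List; []; _∷_; _++_; length; filter; allFin; cartesianProduct)
open import Data.Nat.Base as ℕ using (ℕ; zero; suc; _≥_)
import Data.Nat.Properties as ℕ
import Data.Nat.Tactic.RingSolver as ℕ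
open import Data.Product.Base using (_×_; _,_; ∃-syntax; proj₁; proj₂)
open import Data.Sum.Base using (_⊎_; inj₁; inj₂)
open import Data.Vec.Base using (lookup)
open import Data.Vec.Functional using (Vector; insertAt)
open import Data.Vec.Functional.Properties using (insertAt-lookup; insertAt-punchIn)
open import Data.Vec.Properties using (lookup⇒[]=; []=⇒lookup)
open import Function.Base using (_∘_; id)
open import Function.Bundles using (_⇔_; mk⇔)
open import Relation.Binary.Construct.Closure.ReflexiveTransitive using (Star; _◅_; _◅◅_) renaming (ε to nil)
open import Relation.Binary.PropositionalEquality using (_≡_; _≢_; refl; sym; trans; cong; cong₂; subst; subst₂; module ≡-Reasoning)
open import Relation.Nullary.Decidable using (Dec; yes; no; does; ¬?; _×-dec_; dec-true; dec-false)
open import Relation.Nullary.Negation using (¬_; contradiction)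
open import Relation.Unary using (Pred; Decidable)
open import Algebra.Properties.Semiring.Sum ℤ.+-*-semiring using (sum; sum-syntax; sum-cong-≗; sum-replicate-zero; sum-remove; ∑-distrib-+; ∑-comm; *-distribˡ-sum; *-distribʳ-sum)
open import Algebra.Properties.AbelianGroup ℤ.+-0-abelianGroup using (∙-cancelˡ)
open ≡-Reasoning

-- The row sums of S = M - Mᵀ are the imbalances, and S is antisymmetric; both identities for a
-- kernel vector z come from reading M z = 0 as an equation for S z. The first of them also shows
-- that ∑ z is nonzero, so that Cauchy-Schwarz may be divided by its square. Everything stays in the
-- integers: each use of Cauchy-Schwarz is the nonnegativity of an explicit square norm. Why a mixed
-- extension cannot reach m²: with P out-neighbours and Q in-neighbours, the new vertex contributes
-- (P - Q)² = m² - 4PQ to D, and the old vertices at most 2m + 4 min(P, Q), which is too little once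
-- m ≥ 5. Why minimizers of D are recognizable: the order fixes the parity of all imbalances, so the
-- least possible square can be attained at every vertex at once, and a minimizer must attain it at
-- each of them. The determinant is a bare Laplace expansion along the first row, so a kernel vector
-- has to be won from sign changes under row swaps alone.

private
  variable
    m n : ℕ

-- Finite sums.

∑-zero : {f : Vector ℤ n} → (∀ i → f i ≡ 0ℤ) → sum f ≡ 0ℤ
∑-zero {n = n} f≡0 = trans (sum-cong-≗ f≡0) (sum-replicate-zero n)

∑-neg : (f : Vector ℤ n) → ∑[ i < n ] (- f i) ≡ - sum f
∑-neg {n = zero}  f = refl
∑-neg {n = suc n} f = trans (cong (_+_ (- f zero)) (∑-neg (f ∘ suc))) (sym (ℤ.neg-distrib-+ (f zero) _))

-- Row operations on determinants, and kernel vectors of singular matrices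

det-cong : {A B : Matrix n} → (∀ i j → A i j ≡ B i j) → det A ≡ det B
det-cong {n = zero}  A≡B = refl
det-cong {n = suc n} {A} {B} A≡B = sum-cong-≗ λ j → cong₂ (λ a d → -1ℤ ^ toℕ j * a * d)
  (A≡B zero j) (det-cong λ i k → A≡B (suc i) (punchIn j k))

-- (j , k) ↦ (punchIn j k , pinch k j) sends a pair of distinct columns
-- (j , punchIn j k) to the same pair in the opposite order.
∑-punchIn-pinch : (φ : Fin (suc n) → Fin n → ℤ) →
  ∑[ j < suc n ] ∑[ k < n ] φ (punchIn j k) (pinch k j) ≡ ∑[ j < suc n ] ∑[ k < n ] φ j k
∑-punchIn-pinch {n = zero}  φ = refl
∑-punchIn-pinch {n = suc n} φ = begin
  -- The row j = 0 of the left sum reads the column k = 0 of `φ`, and its column k = 0 reads the row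
  -- j = 0 of `φ`; the remaining terms form the same sum one size smaller.
  c + ∑[ j < suc n ] (φ zero j + ∑[ k < n ] φ (suc (punchIn j k)) (suc (pinch k j)))
    ≡⟨ cong (_+_ c) (∑-distrib-+ (φ zero) (λ j → ∑[ k < n ] φ (suc (punchIn j k)) (suc (pinch k j)))) ⟩
  c + (r + ∑[ j < suc n ] ∑[ k < n ] φ (suc (punchIn j k)) (suc (pinch k j)))
    ≡⟨ cong (λ s → c + (r + s)) (∑-punchIn-pinch λ j k → φ (suc j) (suc k)) ⟩
  c + (r + s)  ≡⟨ exchange c r s ⟩
  r + (c + s)  ≡⟨ cong (_+_ r) (∑-distrib-+ (λ j → φ (suc j) zero) (λ j → ∑[ k < n ] φ (suc j) (suc k))) ⟨
  r + ∑[ j < suc n ] (φ (suc j) zero + ∑[ k < n ] φ (suc j) (suc k)) ∎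
  where
  c r s : ℤ
  c = ∑[ k < suc n ] φ (suc k) zero
  r = ∑[ k < suc n ] φ zero k
  s = ∑[ j < suc n ] ∑[ k < n ] φ (suc j) (suc k)
  exchange : ∀ a b c → a + (b + c) ≡ b + (a + c)
  exchange = solve-∀

punchIn-pinch : (j : Fin (suc n)) (k : Fin n) → punchIn (punchIn j k) (pinch k j) ≡ j
punchIn-pinch zero    zero    = refl
punchIn-pinch zero    (suc k) = refl
punchIn-pinch (suc j) zero    = refl
punchIn-pinch (suc j) (suc k) = cong suc (punchIn-pinch j k)

punchIn-punchIn-pinch : (j : Fin (suc (suc n))) (k : Fin (suc n)) (l : Fin n) →
  punchIn (punchIn j k) (punchIn (pinch k j) l) ≡ punchIn j (punchIn k l)
punchIn-punchIn-pinch zero    zero    l       = refl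
punchIn-punchIn-pinch zero    (suc k) l       = refl
punchIn-punchIn-pinch (suc j) zero    l       = refl
punchIn-punchIn-pinch (suc j) (suc k) zero    = refl
punchIn-punchIn-pinch (suc j) (suc k) (suc l) = cong suc (punchIn-punchIn-pinch j k l)

-- If k < j, the new pair of indices is k and j - 1, otherwise k + 1 and j. Either way the total j +
-- k changes by one, which flips the sign.
sign-pinch : (j : Fin (suc n)) (k : Fin n) →
  -1ℤ ^ toℕ (punchIn j k) * -1ℤ ^ toℕ (pinch k j) ≡ - (-1ℤ ^ toℕ j * -1ℤ ^ toℕ k)
sign-pinch zero    zero    = refl
sign-pinch zero    (suc k) = lemma (-1ℤ ^ toℕ k)
  where
  lemma : ∀ s → -1ℤ * (-1ℤ * s) * 1ℤ ≡ - (1ℤ * (-1ℤ * s))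
  lemma = solve-∀
sign-pinch (suc j) zero    = lemma (-1ℤ ^ toℕ j)
  where
  lemma : ∀ s → 1ℤ * s ≡ - (-1ℤ * s * 1ℤ)
  lemma = solve-∀
sign-pinch (suc j) (suc k) = trans (flip (-1ℤ ^ toℕ (punchIn j k)) (-1ℤ ^ toℕ (pinch k j)))
  (trans (sign-pinch j k) (cong -_ (sym (flip (-1ℤ ^ toℕ j) (-1ℤ ^ toℕ k)))))
  where
  flip : ∀ s t → -1ℤ * s * (-1ℤ * t) ≡ s * t
  flip = solve-∀

swap₀₁ : Matrix (suc (suc n)) → Matrix (suc (suc n))
swap₀₁ A zero          = A (suc zero)
swap₀₁ A (suc zero)    = A zero
swap₀₁ A (suc (suc i)) = A (suc (suc i))

-- The pairs (j , k) run through the ordered pairs of distinct columns used by rows 0 and 1.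
-- Swapping these rows thus becomes a reindexing of the double sum.
det-expand₂ : (A : Matrix (suc (suc n))) → det A ≡
  ∑[ j < suc (suc n) ] ∑[ k < suc n ]
    (-1ℤ ^ toℕ j * A zero j * (-1ℤ ^ toℕ k * A (suc zero) (punchIn j k) * det (minor (minor A zero j) zero k)))
det-expand₂ A = sum-cong-≗ λ j → *-distribˡ-sum (-1ℤ ^ toℕ j * A zero j)
  (λ k → -1ℤ ^ toℕ k * A (suc zero) (punchIn j k) * det (minor (minor A zero j) zero k))

det-swap₀₁ : (A : Matrix (suc (suc n))) → det (swap₀₁ A) ≡ - det A
det-swap₀₁ {n = n} A = begin
  det (swap₀₁ A)                                                ≡⟨ det-expand₂ (swap₀₁ A) ⟩
  ∑[ j < suc (suc n) ] ∑[ k < suc n ] ψ j k                     ≡⟨ ∑-punchIn-pinch ψ ⟨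
  ∑[ j < suc (suc n) ] ∑[ k < suc n ] ψ (punchIn j k) (pinch k j)
    ≡⟨ sum-cong-≗ (λ j → trans (sum-cong-≗ (opposite j)) (∑-neg (φ j))) ⟩
  ∑[ j < suc (suc n) ] (- (∑[ k < suc n ] φ j k))               ≡⟨ ∑-neg (λ j → sum (φ j)) ⟩
  - (∑[ j < suc (suc n) ] ∑[ k < suc n ] φ j k)                 ≡⟨ cong -_ (det-expand₂ A) ⟨
  - det A                                                       ∎
  where
  φ ψ : Fin (suc (suc n)) → Fin (suc n) → ℤ
  φ j k = -1ℤ ^ toℕ j * A zero j * (-1ℤ ^ toℕ k * A (suc zero) (punchIn j k) * det (minor (minor A zero j) zero k))
  ψ j k = -1ℤ ^ toℕ j * A (suc zero) j * (-1ℤ ^ toℕ k * A zero (punchIn j k) * det (minor (minor A zero j) zero k))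

  opposite : ∀ j k → ψ (punchIn j k) (pinch k j) ≡ - φ j k
  opposite j k = begin
    s′ * a * (t′ * A zero (punchIn (punchIn j k) (pinch k j)) * det (minor (minor A zero (punchIn j k)) zero (pinch k j)))
      ≡⟨ cong₂ (λ p d → s′ * a * (t′ * A zero p * d)) (punchIn-pinch j k)
           (det-cong λ i l → cong (A (suc (suc i))) (punchIn-punchIn-pinch j k l)) ⟩
    s′ * a * (t′ * b * d)   ≡⟨ group s′ a t′ b d ⟩
    (s′ * t′) * (a * b * d) ≡⟨ cong (_* (a * b * d)) (sign-pinch j k) ⟩
    - (s * t) * (a * b * d) ≡⟨ ungroup s a t b d ⟩
    - (s * b * (t * a * d)) ∎
    where
    s t s′ t′ a b d : ℤ
    s  = -1ℤ ^ toℕ j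
    t  = -1ℤ ^ toℕ k
    s′ = -1ℤ ^ toℕ (punchIn j k)
    t′ = -1ℤ ^ toℕ (pinch k j)
    a  = A (suc zero) (punchIn j k)
    b  = A zero j
    d  = det (minor (minor A zero j) zero k)
    group : ∀ s a t b d → s * a * (t * b * d) ≡ (s * t) * (a * b * d)
    group = solve-∀
    ungroup : ∀ s a t b d → - (s * t) * (a * b * d) ≡ - (s * b * (t * a * d))
    ungroup = solve-∀

i≡-i⇒i≡0 : ∀ i → i ≡ - i → i ≡ 0ℤ
i≡-i⇒i≡0 (+ zero) _ = refl
i≡-i⇒i≡0 (+ suc n) ()

-- If the equal rows are the first two, swapping them fixes `A`, so its determinant equals its own
-- negative. Otherwise a swap moves row 0 into position 1, and every minor along the new first row
-- repeats a row, now one position closer.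
det-repeated-row : (p : Fin n) (A : Matrix (suc n)) → (∀ j → A zero j ≡ A (suc p) j) → det A ≡ 0ℤ
det-repeated-row {n = suc n} zero A A₀≡A₁ = i≡-i⇒i≡0 (det A) (trans (det-cong A≡swap) (det-swap₀₁ A))
  where
  A≡swap : ∀ i j → A i j ≡ swap₀₁ A i j
  A≡swap zero          j = A₀≡A₁ j
  A≡swap (suc zero)    j = sym (A₀≡A₁ j)
  A≡swap (suc (suc i)) j = refl
det-repeated-row {n = suc n} (suc p) A A₀≡Aₚ = begin
  det A            ≡⟨ ℤ.neg-involutive (det A) ⟨
  - - det A        ≡⟨ cong -_ (det-swap₀₁ A) ⟨
  - det (swap₀₁ A) ≡⟨ cong -_ (∑-zero λ j → trans
                        (cong (-1ℤ ^ toℕ j * A (suc zero) j *_)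
                              (det-repeated-row p (minor (swap₀₁ A) zero j) (A₀≡Aₚ ∘ punchIn j)))
                        (ℤ.*-zeroʳ (-1ℤ ^ toℕ j * A (suc zero) j))) ⟩
  0ℤ               ∎

-- Integer kernel vectors.

infixl 7 _·_
_·_ : Vector ℤ n → Vector ℤ n → ℤ
_·_ {n} x y = ∑[ i < n ] (x i * y i)

NonzeroKernel : (Fin m → Vector ℤ n) → Set
NonzeroKernel A = ∃[ z ] (∃[ p ] z p ≢ 0ℤ) × (∀ i → A i · z ≡ 0ℤ)

·-insertAt : (x : Vector ℤ (suc n)) (z : Vector ℤ n) (j : Fin (suc n)) →
  x · insertAt z j 0ℤ ≡ (x ∘ punchIn j) · z
·-insertAt x z j = begin
  x · insertAt z j 0ℤ  ≡⟨ sum-remove {i = j} (λ k → x k * insertAt z j 0ℤ k) ⟩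
  x j * insertAt z j 0ℤ j + (x ∘ punchIn j) · (insertAt z j 0ℤ ∘ punchIn j)
    ≡⟨ cong₂ _+_ (trans (cong (x j *_) (insertAt-lookup z j 0ℤ)) (ℤ.*-zeroʳ (x j)))
                 (sum-cong-≗ λ k → cong (x (punchIn j k) *_) (insertAt-punchIn z j 0ℤ k)) ⟩
  0ℤ + (x ∘ punchIn j) · z  ≡⟨ ℤ.+-identityˡ _ ⟩
  (x ∘ punchIn j) · z       ∎

·-linear : (x y z : Vector ℤ n) (a b : ℤ) → x · (λ k → a * y k - b * z k) ≡ a * (x · y) - b * (x · z)
·-linear {n = n} x y z a b = begin
  ∑[ k < n ] (x k * (a * y k - b * z k))
    ≡⟨ sum-cong-≗ (λ k → distr (x k) (y k) (z k) a b) ⟩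
  ∑[ k < n ] (a * (x k * y k) + (- b) * (x k * z k))
    ≡⟨ ∑-distrib-+ (λ k → a * (x k * y k)) (λ k → - b * (x k * z k)) ⟩
  ∑[ k < n ] (a * (x k * y k)) + ∑[ k < n ] ((- b) * (x k * z k))
    ≡⟨ cong₂ _+_ (*-distribˡ-sum a (λ k → x k * y k)) (*-distribˡ-sum (- b) (λ k → x k * z k)) ⟨
  a * (x · y) + - b * (x · z)
    ≡⟨ cong (_+_ (a * (x · y))) (ℤ.neg-distribˡ-* b (x · z)) ⟨
  a * (x · y) - b * (x · z) ∎
  where
  distr : ∀ x y z a b → x * (a * y - b * z) ≡ a * (x * y) + (- b) * (x * z)
  distr = solve-∀

-1^n≢0 : ∀ k → -1ℤ ^ k ≢ 0ℤ
-1^n≢0 (suc k) eq with ℤ.i*j≡0⇒i≡0∨j≡0 -1ℤ eq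
... | inj₂ eq′ = -1^n≢0 k eq′

-- Two vectors killed by all rows but the first leave a combination killed by the first row too. It
-- is nonzero because its entry at `p` is (A₀ · z) yₚ; if A₀ · z vanishes, `z` itself serves.
combine-kernels : (A : Fin (suc m) → Vector ℤ n) (y z : Vector ℤ n) (p : Fin n) →
  y p ≢ 0ℤ → z p ≡ 0ℤ → (∃[ q ] z q ≢ 0ℤ) →
  (∀ i → A (suc i) · y ≡ 0ℤ) → (∀ i → A (suc i) · z ≡ 0ℤ) → NonzeroKernel A
combine-kernels A y z p yₚ≢0 zₚ≡0 z≢0 Ay≡0 Az≡0 with A zero · z ℤ.≟ 0ℤ
... | yes A₀z≡0 = z , z≢0 , λ { zero → A₀z≡0 ; (suc i) → Az≡0 i }
... | no  A₀z≢0 = w , (p , wₚ≢0) , Aw≡0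
  where
  w : Vector ℤ _
  w k = (A zero · z) * y k - (A zero · y) * z k
  wₚ≢0 : w p ≢ 0ℤ
  wₚ≢0 eq with ℤ.i*j≡0⇒i≡0∨j≡0 (A zero · z) (trans (sym wₚ≡) eq)
    where
    wₚ≡ : w p ≡ (A zero · z) * y p
    wₚ≡ rewrite zₚ≡0 | ℤ.*-zeroʳ (A zero · y) = ℤ.+-identityʳ _
  ... | inj₁ A₀z≡0 = A₀z≢0 A₀z≡0
  ... | inj₂ yₚ≡0  = yₚ≢0 yₚ≡0
  Aw≡0 : ∀ i → A i · w ≡ 0ℤ
  Aw≡0 zero    = trans (·-linear (A zero) y z (A zero · z) (A zero · y)) (cancel (A zero · z) (A zero · y))
    where
    cancel : ∀ a b → a * b - b * a ≡ 0ℤ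
    cancel = solve-∀
  Aw≡0 (suc i) = trans (·-linear (A (suc i)) y z (A zero · z) (A zero · y))
    (trans (cong₂ (λ s t → (A zero · z) * s - (A zero · y) * t) (Ay≡0 i) (Az≡0 i))
           (cancel (A zero · z) (A zero · y)))
    where
    cancel : ∀ a b → a * 0ℤ - b * 0ℤ ≡ 0ℤ
    cancel = solve-∀

-- The cofactors of the first row form a kernel vector.  If they all vanish,
-- the minors have kernel vectors, which yield vectors killed by all rows but
-- the first with a zero in any prescribed position.
det≡0⇒kernel : (A : Matrix n) → det A ≡ 0ℤ → NonzeroKernel A
det≡0⇒kernel {n = zero}  A ()
det≡0⇒kernel {n = suc n} A detA≡0 with all? (λ j → det (minor A zero j) ℤ.≟ 0ℤ)
... | no ¬minors≡0 = c , (p , cₚ≢0) , Ac≡0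
  where
  c : Vector ℤ (suc n)
  c j = -1ℤ ^ toℕ j * det (minor A zero j)
  nonzero-minor : ∃[ j ] det (minor A zero j) ≢ 0ℤ
  nonzero-minor = ¬∀⟶∃¬ (suc n) _ (λ j → det (minor A zero j) ℤ.≟ 0ℤ) ¬minors≡0
  p : Fin (suc n)
  p = proj₁ nonzero-minor
  cₚ≢0 : c p ≢ 0ℤ
  cₚ≢0 eq with ℤ.i*j≡0⇒i≡0∨j≡0 (-1ℤ ^ toℕ p) eq
  ... | inj₁ sign≡0 = -1^n≢0 (toℕ p) sign≡0
  ... | inj₂ det≡0  = proj₂ nonzero-minor det≡0
  exchange : ∀ a s d → a * (s * d) ≡ s * a * d
  exchange = solve-∀
  -- The product of row i with the cofactors is the determinant of `A` with its first row replaced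
  -- by row i. For i > 0 that matrix has a repeated row.
  replaceRow₀ : Fin (suc n) → Matrix (suc n)
  replaceRow₀ i zero    = A i
  replaceRow₀ i (suc k) = A (suc k)
  Ac≡det : ∀ i → A i · c ≡ det (replaceRow₀ i)
  Ac≡det i = sum-cong-≗ λ j → exchange (A i j) (-1ℤ ^ toℕ j) (det (minor A zero j))
  Ac≡0 : ∀ i → A i · c ≡ 0ℤ
  Ac≡0 zero    = trans (Ac≡det zero) detA≡0
  Ac≡0 (suc i) = trans (Ac≡det (suc i)) (det-repeated-row i (replaceRow₀ (suc i)) λ j → refl)
-- `p` is a position where `extend zero` is nonzero, and `extend p` has a zero there by
-- construction, so the two vectors are independent.
... | yes minors≡0 = combine-kernels A (extend zero) (extend p) p (proj₂ (nonzero zero))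
    (insertAt-lookup (proj₁ (ker p)) p 0ℤ) (nonzero p) (killed zero) (killed p)
  where
  ker : ∀ j → NonzeroKernel (minor A zero j)
  ker j = det≡0⇒kernel (minor A zero j) (minors≡0 j)
  extend : Fin (suc n) → Vector ℤ (suc n)
  extend j = insertAt (proj₁ (ker j)) j 0ℤ
  nonzero : ∀ j → ∃[ q ] extend j q ≢ 0ℤ
  nonzero j with ker j
  ... | z , (q , zq≢0) , _ = punchIn j q , λ eq → zq≢0 (trans (sym (insertAt-punchIn z j 0ℤ q)) eq)
  killed : ∀ j i → A (suc i) · extend j ≡ 0ℤ
  killed j i = trans (·-insertAt (A (suc i)) (proj₁ (ker j)) j) (proj₂ (proj₂ (ker j)) i)
  p : Fin (suc n)
  p = proj₁ (nonzero zero)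

-- Square norms of integer vectors.

ones : Vector ℤ n
ones _ = 1ℤ

∑-ones : ∀ n → ∑[ i < n ] 1ℤ ≡ + n
∑-ones zero    = refl
∑-ones (suc n) = cong (_+_ 1ℤ) (∑-ones n)

·-comm : (x y : Vector ℤ n) → x · y ≡ y · x
·-comm x y = sum-cong-≗ λ i → ℤ.*-comm (x i) (y i)

·-ones : (x : Vector ℤ n) → x · ones ≡ sum x
·-ones x = sum-cong-≗ λ i → ℤ.*-identityʳ (x i)

-- Expands the square norms whose nonnegativity stands in for Cauchy-Schwarz, and also those of
-- imbalances after a vertex is added.
combination-square : (a b : ℤ) (x y : Vector ℤ n) → let w = λ i → a * x i + b * y i in
  w · w ≡ a * a * (x · x) + + 2 * a * b * (x · y) + b * b * (y · y)
combination-square {n = n} a b x y = begin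
  ∑[ i < n ] ((a * x i + b * y i) * (a * x i + b * y i))
    ≡⟨ sum-cong-≗ (λ i → expand a b (x i) (y i)) ⟩
  ∑[ i < n ] (p i + q i + r i)
    ≡⟨ ∑-distrib-+ (λ i → p i + q i) r ⟩
  ∑[ i < n ] (p i + q i) + sum r
    ≡⟨ cong (_+ sum r) (∑-distrib-+ p q) ⟩
  sum p + sum q + sum r
    ≡⟨ cong₂ _+_ (cong₂ _+_ (*-distribˡ-sum (a * a) (λ i → x i * x i)) (*-distribˡ-sum (+ 2 * a * b) (λ i → x i * y i)))
                 (*-distribˡ-sum (b * b) (λ i → y i * y i)) ⟨
  a * a * (x · x) + + 2 * a * b * (x · y) + b * b * (y · y) ∎
  where
  p q r : Vector ℤ n
  p i = a * a * (x i * x i)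
  q i = + 2 * a * b * (x i * y i)
  r i = b * b * (y i * y i)
  expand : ∀ a b x y → (a * x + b * y) * (a * x + b * y) ≡ a * a * (x * x) + + 2 * a * b * (x * y) + b * b * (y * y)
  expand = solve-∀

-- Imbalances of a tournament

I-diagonal : (i : Fin n) → I n i i ≡ 1ℤ
I-diagonal i rewrite dec-true (i ≟ i) refl = refl

I-off-diagonal : {i j : Fin n} → i ≢ j → I n i j ≡ 0ℤ
I-off-diagonal {i = i} {j} i≢j rewrite dec-false (i ≟ j) i≢j = refl

I-· : (i : Fin n) (x : Vector ℤ n) → I n i · x ≡ x i
I-· {n = suc n} i x = begin
  I (suc n) i · x
    ≡⟨ sum-remove {i = i} (λ j → I (suc n) i j * x j) ⟩
  I (suc n) i i * x i + ∑[ k < n ] (I (suc n) i (punchIn i k) * x (punchIn i k))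
    ≡⟨ cong₂ _+_ (cong (_* x i) (I-diagonal i))
         (∑-zero λ k → cong (_* x (punchIn i k)) (I-off-diagonal (punchInᵢ≢i i k ∘ sym))) ⟩
  1ℤ * x i + 0ℤ
    ≡⟨ trans (ℤ.+-identityʳ _) (ℤ.*-identityˡ (x i)) ⟩
  x i ∎

∑-I : (i : Fin n) → ∑[ j < n ] I n i j ≡ 1ℤ
∑-I i = trans (sym (·-ones (I _ i))) (I-· i ones)

Opposite : ℤ → ℤ → Set
Opposite a b = (a ≡ 1ℤ × b ≡ 0ℤ) ⊎ (a ≡ 0ℤ × b ≡ 1ℤ)

skew : Tournament n → Fin n → Fin n → ℤ
skew M i j = matrix M i j - matrix M j i

-- This is d(i) of the overview, and `irregularity` below is D.
imbalance : Tournament n → Vector ℤ n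
imbalance {n} M i = ∑[ j < n ] skew M i j

irregularity : Tournament n → ℤ
irregularity M = imbalance M · imbalance M

skew-antisym : (M : Tournament n) (i j : Fin n) → skew M i j ≡ - skew M j i
skew-antisym M i j = lemma (matrix M i j) (matrix M j i)
  where
  lemma : ∀ a b → a - b ≡ - (b - a)
  lemma = solve-∀

∑∑-antisym : (σ : Fin n → Fin n → ℤ) → (∀ i j → σ i j ≡ - σ j i) → ∑[ i < n ] ∑[ j < n ] σ i j ≡ 0ℤ
∑∑-antisym {n = n} σ anti = i≡-i⇒i≡0 _ (begin
  ∑[ i < n ] ∑[ j < n ] σ i j        ≡⟨ ∑-comm σ ⟩
  ∑[ j < n ] ∑[ i < n ] σ i j        ≡⟨ sum-cong-≗ (λ j → trans (sum-cong-≗ λ i → anti i j) (∑-neg (σ j))) ⟩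
  ∑[ j < n ] (- (∑[ i < n ] σ j i))  ≡⟨ ∑-neg (λ j → sum (σ j)) ⟩
  - (∑[ i < n ] ∑[ j < n ] σ i j)    ∎)

∑-imbalance : (M : Tournament n) → sum (imbalance M) ≡ 0ℤ
∑-imbalance M = ∑∑-antisym (skew M) (skew-antisym M)

module _ (M : Tournament n) where

  opposite : ∀ {i j} → i ≢ j → Opposite (matrix M i j) (matrix M j i)
  opposite {i} {j} i≢j = from (zero-one M i j) (zero-one M j i)
    (trans (M+Mᵀ≡J-I M i j) (cong (_-_ 1ℤ) (I-off-diagonal i≢j)))
    where
    from : ∀ {a b} → a ≡ 0ℤ ⊎ a ≡ 1ℤ → b ≡ 0ℤ ⊎ b ≡ 1ℤ → a + b ≡ 1ℤ → Opposite a b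
    from (inj₁ refl) (inj₁ refl) ()
    from (inj₁ refl) (inj₂ refl) _ = inj₂ (refl , refl)
    from (inj₂ refl) (inj₁ refl) _ = inj₁ (refl , refl)
    from (inj₂ refl) (inj₂ refl) ()

  skew-±1 : ∀ {i j} → i ≢ j → skew M i j ≡ 1ℤ ⊎ skew M i j ≡ -1ℤ
  skew-±1 i≢j with opposite i≢j
  ... | inj₁ (a≡1 , b≡0) = inj₁ (cong₂ _-_ a≡1 b≡0)
  ... | inj₂ (a≡0 , b≡1) = inj₂ (cong₂ _-_ a≡0 b≡1)

  skew-square : ∀ {i j} → i ≢ j → skew M i j * skew M i j ≡ 1ℤ
  skew-square i≢j with skew-±1 i≢j
  ... | inj₁ s≡1  = cong₂ _*_ s≡1 s≡1
  ... | inj₂ s≡-1 = cong₂ _*_ s≡-1 s≡-1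

  arc⇒skew : ∀ {i j} → Arc M i j → skew M i j ≡ 1ℤ
  arc⇒skew {i} {j} a≡1 with zero-one M j i
  ... | inj₁ b≡0 = cong₂ _-_ a≡1 b≡0
  -- Both entries being 1 would make their sum 2, while J - I has only the entries 0 and 1.
  ... | inj₂ b≡1 with i ≟ j | trans (sym (cong₂ _+_ a≡1 b≡1)) (M+Mᵀ≡J-I M i j)
  ...   | yes refl | ()
  ...   | no _     | ()

  -- In matrix form S = 2M - J + I. This carries both row sums and kernel vectors from `M` to its
  -- antisymmetric part.
  skew≡2M-1+I : ∀ i j → skew M i j ≡ + 2 * matrix M i j - 1ℤ + I n i j
  skew≡2M-1+I i j = begin
    a - b                ≡⟨ regroup a b ⟩
    + 2 * a - (a + b)    ≡⟨ cong (λ s → + 2 * a - s) (M+Mᵀ≡J-I M i j) ⟩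
    + 2 * a - (1ℤ - I n i j) ≡⟨ ungroup a (I n i j) ⟩
    + 2 * a - 1ℤ + I n i j ∎
    where
    a = matrix M i j
    b = matrix M j i
    regroup : ∀ a b → a - b ≡ + 2 * a - (a + b)
    regroup = solve-∀
    ungroup : ∀ a e → + 2 * a - (1ℤ - e) ≡ + 2 * a - 1ℤ + e
    ungroup = solve-∀

  imbalance≡ : ∀ i → imbalance M i ≡ + 2 * sum (matrix M i) - + n + 1ℤ
  imbalance≡ i = begin
    ∑[ j < n ] skew M i j                                    ≡⟨ sum-cong-≗ (skew≡2M-1+I i) ⟩
    ∑[ j < n ] (+ 2 * matrix M i j - 1ℤ + I n i j)           ≡⟨ ∑-distrib-+ (λ j → + 2 * matrix M i j - 1ℤ) (I n i) ⟩
    ∑[ j < n ] (+ 2 * matrix M i j - 1ℤ) + sum (I n i)       ≡⟨ cong₂ _+_ (∑-distrib-+ (λ j → + 2 * matrix M i j) (λ _ → -1ℤ)) (∑-I i) ⟩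
    ∑[ j < n ] (+ 2 * matrix M i j) + ∑[ j < n ] -1ℤ + 1ℤ    ≡⟨ cong₂ (λ s t → s + t + 1ℤ) (sym (*-distribˡ-sum (+ 2) (matrix M i)))
                                                                  (trans (∑-neg {n} ones) (cong -_ (∑-ones n))) ⟩
    + 2 * sum (matrix M i) - + n + 1ℤ                        ∎

-- Counting by sums

⟦_⟧ : Bool → ℤ
⟦ true ⟧  = 1ℤ
⟦ false ⟧ = 0ℤ

listSum : ∀ {a} {A : Set a} → (A → ℤ) → List A → ℤ
listSum f []       = 0ℤ
listSum f (x ∷ xs) = f x + listSum f xs

length-filter : ∀ {a p} {A : Set a} {P : Pred A p} (P? : Decidable P) xs →
  + length (filter P? xs) ≡ listSum (λ x → ⟦ does (P? x) ⟧) xs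
length-filter P? []       = refl
length-filter P? (x ∷ xs) with does (P? x)
... | true  = cong (_+_ 1ℤ) (length-filter P? xs)
... | false = trans (length-filter P? xs) (sym (ℤ.+-identityˡ _))

listSum-tabulate : ∀ {a} {A : Set a} (g : A → ℤ) (f : Fin n → A) → listSum g (List.tabulate f) ≡ ∑[ i < n ] g (f i)
listSum-tabulate {n = zero}  g f = refl
listSum-tabulate {n = suc n} g f = cong (_+_ (g (f zero))) (listSum-tabulate g (f ∘ suc))

listSum-map-++ : ∀ {a b} {A : Set a} {B : Set b} (g : B → ℤ) (f : A → B) xs ys →
  listSum g (List.map f xs ++ ys) ≡ listSum (g ∘ f) xs + listSum g ys
listSum-map-++ g f []       ys = sym (ℤ.+-identityˡ _)
listSum-map-++ g f (x ∷ xs) ys = trans (cong (_+_ (g (f x))) (listSum-map-++ g f xs ys))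
  (sym (ℤ.+-assoc (g (f x)) _ _))

listSum-product : ∀ {a b} {A : Set a} {B : Set b} (g : A × B → ℤ) (f : Fin n → A) ys →
  listSum g (cartesianProduct (List.tabulate f) ys) ≡ ∑[ i < n ] listSum (λ y → g (f i , y)) ys
listSum-product {n = zero}  g f ys = refl
listSum-product {n = suc n} g f ys = trans (listSum-map-++ g (f zero ,_) ys _)
  (cong (_+_ (listSum (λ y → g (f zero , y)) ys)) (listSum-product g (f ∘ suc) ys))

outdegree≡∑ : (M : Tournament n) (i : Fin n) → + outdegree M i ≡ sum (matrix M i)
outdegree≡∑ {n} M i = begin
  + outdegree M i                               ≡⟨ length-filter (arc? M i) (allFin n) ⟩
  listSum (λ j → ⟦ does (arc? M i j) ⟧) (allFin n) ≡⟨ listSum-tabulate (λ j → ⟦ does (arc? M i j) ⟧) id ⟩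
  ∑[ j < n ] ⟦ does (arc? M i j) ⟧              ≡⟨ sum-cong-≗ (λ j → indicator (zero-one M i j)) ⟩
  sum (matrix M i)                              ∎
  where
  indicator : ∀ {a} → a ≡ 0ℤ ⊎ a ≡ 1ℤ → ⟦ does (a ℤ.≟ 1ℤ) ⟧ ≡ a
  indicator (inj₁ refl) = refl
  indicator (inj₂ refl) = refl

imbalance≡2outdegree : (M : Tournament n) (i : Fin n) → imbalance M i ≡ + 2 * + outdegree M i - + n + 1ℤ
imbalance≡2outdegree {n} M i = trans (imbalance≡ M i) (cong (λ s → + 2 * s - + n + 1ℤ) (sym (outdegree≡∑ M i)))

-- The factor 2 is the point: all imbalances in tournaments of one order have the same parity.
imbalance-difference : (M N : Tournament n) (i j : Fin n) →
  imbalance M i - imbalance N j ≡ + 2 * (+ outdegree M i - + outdegree N j)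
imbalance-difference {n} M N i j = trans
  (cong₂ _-_ (imbalance≡2outdegree M i) (imbalance≡2outdegree N j))
  (collect (+ outdegree M i) (+ outdegree N j) (+ n))
  where
  collect : ∀ r s n → (+ 2 * r - n + 1ℤ) - (+ 2 * s - n + 1ℤ) ≡ + 2 * (r - s)
  collect = solve-∀

-- The relation between cyclic triples and imbalances

-- Sums over increasing pairs and, below, increasing triples. The recursion splits off the smallest
-- index to suit an induction that removes vertex 0.
∑₂ : (Fin n → Fin n → ℤ) → ℤ
∑₂ {zero}  f = 0ℤ
∑₂ {suc n} f = ∑[ k < n ] f zero (suc k) + ∑₂ (λ j k → f (suc j) (suc k))

∑₃ : (Fin n → Fin n → Fin n → ℤ) → ℤ
∑₃ {zero}  f = 0ℤ
∑₃ {suc n} f = ∑₂ (λ j k → f zero (suc j) (suc k)) + ∑₃ (λ i j k → f (suc i) (suc j) (suc k))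

[_<_] : Fin n → Fin n → ℤ
[ i < j ] = ⟦ does (i <? j) ⟧

∑-drop₀ : (f : Vector ℤ (suc n)) → f zero ≡ 0ℤ → sum f ≡ sum (f ∘ suc)
∑-drop₀ f f₀≡0 = trans (cong (_+ sum (f ∘ suc)) f₀≡0) (ℤ.+-identityˡ _)

∑₂-indicator : (f : Fin n → Fin n → ℤ) → ∑[ j < n ] ∑[ k < n ] ([ j < k ] * f j k) ≡ ∑₂ f
∑₂-indicator {n = zero}  f = refl
∑₂-indicator {n = suc n} f = cong₂ _+_
  (trans (∑-drop₀ (λ k → [ zero < k ] * f zero k) refl)
         (sum-cong-≗ λ k → ℤ.*-identityˡ (f zero (suc k))))
  (trans (sum-cong-≗ λ j → ∑-drop₀ (λ k → [ suc j < k ] * f (suc j) k) refl)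
         (∑₂-indicator λ j k → f (suc j) (suc k)))

∑₃-indicator : (f : Fin n → Fin n → Fin n → ℤ) →
  ∑[ i < n ] ∑[ j < n ] ∑[ k < n ] ([ i < j ] * [ j < k ] * f i j k) ≡ ∑₃ f
∑₃-indicator {n = zero}  f = refl
∑₃-indicator {n = suc n} f = cong₂ _+_
  (begin
    ∑[ j < suc n ] ∑[ k < suc n ] g zero j k
      ≡⟨ ∑-drop₀ (λ j → ∑[ k < suc n ] g zero j k) (∑-zero {n = suc n} λ k → refl) ⟩
    ∑[ j < n ] ∑[ k < suc n ] g zero (suc j) k
      ≡⟨ sum-cong-≗ (λ j → ∑-drop₀ (g zero (suc j)) refl) ⟩
    ∑[ j < n ] ∑[ k < n ] (1ℤ * [ j < k ] * f zero (suc j) (suc k))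
      ≡⟨ sum-cong-≗ (λ j → sum-cong-≗ λ k → cong (_* f zero (suc j) (suc k)) (ℤ.*-identityˡ [ j < k ])) ⟩
    ∑[ j < n ] ∑[ k < n ] ([ j < k ] * f zero (suc j) (suc k))
      ≡⟨ ∑₂-indicator (λ j k → f zero (suc j) (suc k)) ⟩
    ∑₂ (λ j k → f zero (suc j) (suc k)) ∎)
  (begin
    ∑[ i < n ] ∑[ j < suc n ] ∑[ k < suc n ] g (suc i) j k
      ≡⟨ sum-cong-≗ (λ i → ∑-drop₀ (λ j → ∑[ k < suc n ] g (suc i) j k) (∑-zero {n = suc n} λ k → refl)) ⟩
    ∑[ i < n ] ∑[ j < n ] ∑[ k < suc n ] g (suc i) (suc j) k
      ≡⟨ sum-cong-≗ (λ i → sum-cong-≗ λ j → ∑-drop₀ (g (suc i) (suc j))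
           (cong (_* f (suc i) (suc j) zero) (ℤ.*-zeroʳ [ i < j ]))) ⟩
    ∑[ i < n ] ∑[ j < n ] ∑[ k < n ] g (suc i) (suc j) (suc k)
      ≡⟨ ∑₃-indicator (λ i j k → f (suc i) (suc j) (suc k)) ⟩
    ∑₃ (λ i j k → f (suc i) (suc j) (suc k)) ∎)
  where
  g : Fin (suc n) → Fin (suc n) → Fin (suc n) → ℤ
  g i j k = [ i < j ] * [ j < k ] * f i j k

∑₂-cong : {f g : Fin n → Fin n → ℤ} → (∀ j k → f j k ≡ g j k) → ∑₂ f ≡ ∑₂ g
∑₂-cong {n = zero}  f≡g = refl
∑₂-cong {n = suc n} f≡g = cong₂ _+_ (sum-cong-≗ λ k → f≡g zero (suc k)) (∑₂-cong λ j k → f≡g (suc j) (suc k))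

∑₂-distrib-+ : (f g : Fin n → Fin n → ℤ) → ∑₂ (λ j k → f j k + g j k) ≡ ∑₂ f + ∑₂ g
∑₂-distrib-+ {n = zero}  f g = refl
∑₂-distrib-+ {n = suc n} f g = trans
  (cong₂ _+_ (∑-distrib-+ (λ k → f zero (suc k)) (λ k → g zero (suc k)))
             (∑₂-distrib-+ (λ j k → f (suc j) (suc k)) (λ j k → g (suc j) (suc k))))
  (regroup (∑[ k < n ] f zero (suc k)) (∑[ k < n ] g zero (suc k)) (∑₂ λ j k → f (suc j) (suc k)) (∑₂ λ j k → g (suc j) (suc k)))
  where
  regroup : ∀ a b c d → a + b + (c + d) ≡ a + c + (b + d)
  regroup = solve-∀

∑₂-symmetrize : (f : Fin n → Fin n → ℤ) →
  ∑₂ (λ j k → f j k + f k j) + ∑[ j < n ] f j j ≡ ∑[ j < n ] ∑[ k < n ] f j k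
∑₂-symmetrize {n = zero}  f = refl
∑₂-symmetrize {n = suc n} f = begin
  ∑[ k < n ] (r k + c k) + s + (d + ds)  ≡⟨ cong (λ t → t + s + (d + ds)) (∑-distrib-+ r c) ⟩
  sum r + sum c + s + (d + ds)           ≡⟨ regroup (sum r) (sum c) s d ds ⟩
  d + sum r + (sum c + (s + ds))         ≡⟨ cong (λ t → d + sum r + (sum c + t)) (∑₂-symmetrize λ j k → f (suc j) (suc k)) ⟩
  d + sum r + (sum c + ∑[ j < n ] ∑[ k < n ] f (suc j) (suc k))
    ≡⟨ cong (_+_ (d + sum r)) (∑-distrib-+ c (λ j → ∑[ k < n ] f (suc j) (suc k))) ⟨
  ∑[ j < suc n ] ∑[ k < suc n ] f j k    ∎
  where
  r c : Vector ℤ n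
  r k = f zero (suc k)
  c k = f (suc k) zero
  s d ds : ℤ
  s  = ∑₂ λ j k → f (suc j) (suc k) + f (suc k) (suc j)
  d  = f zero zero
  ds = ∑[ j < n ] f (suc j) (suc j)
  regroup : ∀ r c s d ds → r + c + s + (d + ds) ≡ d + r + (c + (s + ds))
  regroup = solve-∀

-- Equal to n (n - 1) + 2 (n choose 3); only the independence of the tournament matters.
moonConstant : ℕ → ℤ
moonConstant zero    = 0ℤ
moonConstant (suc n) = ∑₂ {n} (λ _ _ → + 2) + + 2 * + n + moonConstant n

-- For an antisymmetric ±1 matrix: 8 on cyclic triples and 0 on transitive ones.
cyclicity : (Fin n → Fin n → ℤ) → Fin n → Fin n → Fin n → ℤ
cyclicity σ i j k = + 2 * (1ℤ + σ i j * σ j k + σ j k * σ k i + σ k i * σ i j)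

-- Remove vertex 0, with row `x`. The other imbalances were `e` and become `e - x`, so D changes by
-- (∑ x)² - 2 (x · e) + n; the triples through vertex 0 contribute the negative of this, up to a
-- constant depending on n only. Working with sign arrays instead of tournaments makes the
-- restriction `τ` available at no cost.
∑₃-cyclicity : (σ : Fin n → Fin n → ℤ) → (∀ i j → σ i j ≡ - σ j i) → (∀ {i j} → i ≢ j → σ i j * σ i j ≡ 1ℤ) →
  let d = λ i → sum (σ i) in ∑₃ (cyclicity σ) + d · d ≡ moonConstant n
∑₃-cyclicity {n = zero}  σ anti unit = refl
∑₃-cyclicity {n = suc n} σ anti unit = begin
  c₀ + c + (d₀ * d₀ + d₁ · d₁)              ≡⟨ cong₂ (λ s t → c₀ + c + (s * s + t)) d₀≡ d₁²≡ ⟩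
  c₀ + c + (sum x * sum x + (e · e - + 2 * (x · e) + + n))
                                            ≡⟨ regroup c₀ c (sum x) (e · e) (x · e) (+ n) ⟩
  c₀ + (sum x * sum x - + 2 * (x · e) + + n) + (c + e · e)
    ≡⟨ cong₂ _+_ c₀≡ (∑₃-cyclicity τ (λ i j → anti (suc i) (suc j)) λ i≢j → unit λ { refl → i≢j refl }) ⟩
  ∑₂ {n} (λ _ _ → + 2) + + 2 * + n + moonConstant n ∎
  where
  x e d₁ : Vector ℤ n
  τ : Fin n → Fin n → ℤ
  x j = σ zero (suc j)
  τ j k = σ (suc j) (suc k)
  e j = sum (τ j)
  d₁ j = sum (σ (suc j))
  c₀ c d₀ : ℤ
  c₀ = ∑₂ λ j k → cyclicity σ zero (suc j) (suc k)
  c  = ∑₃ (cyclicity τ)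
  d₀ = sum (σ zero)

  regroup : ∀ c₀ c X E P N → c₀ + c + (X * X + (E - + 2 * P + N)) ≡ c₀ + (X * X - + 2 * P + N) + (c + E)
  regroup = solve-∀

  diag : ∀ i → σ i i ≡ 0ℤ
  diag i = i≡-i⇒i≡0 _ (anti i i)

  x·x≡n : x · x ≡ + n
  x·x≡n = trans (sum-cong-≗ λ j → unit {zero} {suc j} λ ()) (∑-ones n)

  d₀≡ : d₀ ≡ sum x
  d₀≡ = trans (cong (_+ sum x) (diag zero)) (ℤ.+-identityˡ _)

  d₁²≡ : d₁ · d₁ ≡ e · e - + 2 * (x · e) + + n
  d₁²≡ = begin
    d₁ · d₁ ≡⟨ sum-cong-≗ (λ j → cong (λ t → t * t) (d₁≡ j)) ⟩
    w · w   ≡⟨ combination-square -1ℤ 1ℤ x e ⟩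
    -1ℤ * -1ℤ * (x · x) + + 2 * -1ℤ * 1ℤ * (x · e) + 1ℤ * 1ℤ * (e · e)
            ≡⟨ cong (λ t → -1ℤ * -1ℤ * t + + 2 * -1ℤ * 1ℤ * (x · e) + 1ℤ * 1ℤ * (e · e)) x·x≡n ⟩
    -1ℤ * -1ℤ * + n + + 2 * -1ℤ * 1ℤ * (x · e) + 1ℤ * 1ℤ * (e · e)
            ≡⟨ tidy (+ n) (x · e) (e · e) ⟩
    e · e - + 2 * (x · e) + + n ∎
    where
    w : Vector ℤ n
    w j = -1ℤ * x j + 1ℤ * e j
    d₁≡ : ∀ j → d₁ j ≡ w j
    d₁≡ j = cong₂ _+_ (trans (anti (suc j) zero) (sym (ℤ.-1*i≡-i (x j)))) (sym (ℤ.*-identityˡ (e j)))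
    tidy : ∀ N P E → -1ℤ * -1ℤ * N + + 2 * -1ℤ * 1ℤ * P + 1ℤ * 1ℤ * E ≡ E - + 2 * P + N
    tidy = solve-∀

  -- Chosen so that `g j k + g k j` is the cyclicity of (0, j, k) less 2; a sum over increasing
  -- pairs then becomes a full double sum without its diagonal.
  g : Fin n → Fin n → ℤ
  g j k = + 2 * (x j * τ j k) - x j * x k

  ∑g-diagonal : ∑[ j < n ] g j j ≡ - + n
  ∑g-diagonal = trans (sum-cong-≗ step) (trans (∑-neg (λ j → x j * x j)) (cong -_ x·x≡n))
    where
    tidy : ∀ a → + 2 * (a * 0ℤ) - a * a ≡ - (a * a)
    tidy = solve-∀
    step : ∀ j → g j j ≡ - (x j * x j)
    step j = trans (cong (λ t → + 2 * (x j * t) - x j * x j) (diag (suc j))) (tidy (x j))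

  ∑∑g : ∑[ j < n ] ∑[ k < n ] g j k ≡ + 2 * (x · e) - sum x * sum x
  ∑∑g = begin
    ∑[ j < n ] ∑[ k < n ] g j k
      ≡⟨ sum-cong-≗ row ⟩
    ∑[ j < n ] (+ 2 * (x j * e j) + - (x j * sum x))
      ≡⟨ ∑-distrib-+ (λ j → + 2 * (x j * e j)) (λ j → - (x j * sum x)) ⟩
    ∑[ j < n ] (+ 2 * (x j * e j)) + ∑[ j < n ] (- (x j * sum x))
      ≡⟨ cong₂ _+_ (sym (*-distribˡ-sum (+ 2) (λ j → x j * e j)))
           (trans (∑-neg (λ j → x j * sum x)) (cong -_ (sym (*-distribʳ-sum (sum x) x)))) ⟩
    + 2 * (x · e) - sum x * sum x ∎
    where
    assoc : ∀ a b → + 2 * (a * b) ≡ + 2 * a * b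
    assoc = solve-∀
    row : ∀ j → ∑[ k < n ] g j k ≡ + 2 * (x j * e j) + - (x j * sum x)
    row j = begin
      ∑[ k < n ] (+ 2 * (x j * τ j k) + - (x j * x k))
        ≡⟨ ∑-distrib-+ (λ k → + 2 * (x j * τ j k)) (λ k → - (x j * x k)) ⟩
      ∑[ k < n ] (+ 2 * (x j * τ j k)) + ∑[ k < n ] (- (x j * x k))
        ≡⟨ cong₂ _+_ (trans (sym (*-distribˡ-sum (+ 2) (λ k → x j * τ j k))) (cong (_*_ (+ 2)) (sym (*-distribˡ-sum (x j) (τ j)))))
             (trans (∑-neg (λ k → x j * x k)) (cong -_ (sym (*-distribˡ-sum (x j) x)))) ⟩
      + 2 * (x j * e j) + - (x j * sum x) ∎

  c₀≡ : c₀ + (sum x * sum x - + 2 * (x · e) + + n) ≡ ∑₂ {n} (λ _ _ → + 2) + + 2 * + n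
  c₀≡ = begin
    c₀ + (sum x * sum x - + 2 * (x · e) + + n)
      ≡⟨ cong (_+ (sum x * sum x - + 2 * (x · e) + + n)) (trans (∑₂-cong split) (∑₂-distrib-+ (λ _ _ → + 2) (λ j k → g j k + g k j))) ⟩
    A + G + (sum x * sum x - + 2 * (x · e) + + n)
      ≡⟨ to-difference A G (sum x * sum x) (+ 2 * (x · e)) (+ n) ⟩
    A + ((G - + n) - (+ 2 * (x · e) - sum x * sum x)) + + 2 * + n
      ≡⟨ cong (λ t → A + ((G + t) - (+ 2 * (x · e) - sum x * sum x)) + + 2 * + n) (sym ∑g-diagonal) ⟩
    A + ((G + ∑[ j < n ] g j j) - (+ 2 * (x · e) - sum x * sum x)) + + 2 * + n
      ≡⟨ cong (λ t → A + (t - (+ 2 * (x · e) - sum x * sum x)) + + 2 * + n) (trans (∑₂-symmetrize g) ∑∑g) ⟩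
    A + ((+ 2 * (x · e) - sum x * sum x) - (+ 2 * (x · e) - sum x * sum x)) + + 2 * + n
      ≡⟨ cancel A (+ 2 * (x · e) - sum x * sum x) (+ 2 * + n) ⟩
    A + + 2 * + n ∎
    where
    A G : ℤ
    A = ∑₂ {n} λ _ _ → + 2
    G = ∑₂ λ j k → g j k + g k j
    to-difference : ∀ A G X P N → A + G + (X - P + N) ≡ A + ((G - N) - (P - X)) + + 2 * N
    to-difference = solve-∀
    cancel : ∀ A B C → A + (B - B) + C ≡ A + C
    cancel = solve-∀
    expand : ∀ a b t → + 2 * (1ℤ + a * t + t * (- b) + (- b) * a) ≡ + 2 + ((+ 2 * (a * t) - a * b) + (+ 2 * (b * (- t)) - b * a))
    expand = solve-∀
    split : ∀ j k → cyclicity σ zero (suc j) (suc k) ≡ + 2 + (g j k + g k j)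
    split j k = begin
      cyclicity σ zero (suc j) (suc k)
        ≡⟨ cong (λ s → + 2 * (1ℤ + x j * τ j k + τ j k * s + s * x j)) (anti (suc k) zero) ⟩
      + 2 * (1ℤ + x j * τ j k + τ j k * (- x k) + (- x k) * x j)
        ≡⟨ expand (x j) (x k) (τ j k) ⟩
      + 2 + (g j k + (+ 2 * (x k * (- τ j k)) - x k * x j))
        ≡⟨ cong (λ s → + 2 + (g j k + (+ 2 * (x k * s) - x k * x j))) (anti (suc k) (suc j)) ⟨
      + 2 + (g j k + g k j) ∎

-- Cyclic triples counted by signs.

-- The identity is demanded only where both guards hold: the arc values are known to be opposite
-- only for distinct vertices. Elsewhere both sides vanish.
guarded-indicator : ∀ {p q} {P : Set p} {Q : Set q} (P? : Dec P) (Q? : Dec Q) (b : Bool) {c y : ℤ} →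
  (P → Q → ⟦ b ⟧ * c ≡ y) → ⟦ (does P? ∧ does Q?) ∧ b ⟧ * c ≡ ⟦ does P? ⟧ * ⟦ does Q? ⟧ * y
guarded-indicator (yes p) (yes q) b eq = trans (eq p q) (sym (ℤ.*-identityˡ _))
guarded-indicator (yes p) (no _)  b eq = refl
guarded-indicator (no _)  _       b eq = refl

-- The triple is cyclic exactly when the three signs agree, and then 1 + στ + τυ + υσ = 4. Otherwise
-- one product is 1 and two are -1.
cyclicity-indicator : ∀ {a a′ b b′ c c′} → Opposite a a′ → Opposite b b′ → Opposite c c′ →
  let σ = a - a′ ; τ = b - b′ ; υ = c - c′ in
  ⟦ (does (a ℤ.≟ 1ℤ) ∧ does (b ℤ.≟ 1ℤ) ∧ does (c ℤ.≟ 1ℤ))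
    ∨ (does (c′ ℤ.≟ 1ℤ) ∧ does (b′ ℤ.≟ 1ℤ) ∧ does (a′ ℤ.≟ 1ℤ)) ⟧ * + 8
  ≡ + 2 * (1ℤ + σ * τ + τ * υ + υ * σ)
cyclicity-indicator (inj₁ (refl , refl)) (inj₁ (refl , refl)) (inj₁ (refl , refl)) = refl
cyclicity-indicator (inj₁ (refl , refl)) (inj₁ (refl , refl)) (inj₂ (refl , refl)) = refl
cyclicity-indicator (inj₁ (refl , refl)) (inj₂ (refl , refl)) (inj₁ (refl , refl)) = refl
cyclicity-indicator (inj₁ (refl , refl)) (inj₂ (refl , refl)) (inj₂ (refl , refl)) = refl
cyclicity-indicator (inj₂ (refl , refl)) (inj₁ (refl , refl)) (inj₁ (refl , refl)) = refl
cyclicity-indicator (inj₂ (refl , refl)) (inj₁ (refl , refl)) (inj₂ (refl , refl)) = refl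
cyclicity-indicator (inj₂ (refl , refl)) (inj₂ (refl , refl)) (inj₁ (refl , refl)) = refl
cyclicity-indicator (inj₂ (refl , refl)) (inj₂ (refl , refl)) (inj₂ (refl , refl)) = refl

C₃≡∑₃ : (M : Tournament n) → + C₃ M * + 8 ≡ ∑₃ (cyclicity (skew M))
C₃≡∑₃ {n} M = begin
  + C₃ M * + 8
    ≡⟨ cong (_* + 8) (trans (length-filter (cyclicTriple? M) (triples n))
         (trans (listSum-product f id (cartesianProduct (allFin n) (allFin n)))
         (sum-cong-≗ λ i → trans (listSum-product (λ p → f (i , p)) id (allFin n))
         (sum-cong-≗ λ j → listSum-tabulate (λ k → f (i , j , k)) id)))) ⟩
  (∑[ i < n ] ∑[ j < n ] ∑[ k < n ] f (i , j , k)) * + 8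
    ≡⟨ trans (*-distribʳ-sum (+ 8) (λ i → ∑[ j < n ] ∑[ k < n ] f (i , j , k)))
       (sum-cong-≗ λ i → trans (*-distribʳ-sum (+ 8) (λ j → ∑[ k < n ] f (i , j , k)))
       (sum-cong-≗ λ j → *-distribʳ-sum (+ 8) (λ k → f (i , j , k)))) ⟩
  ∑[ i < n ] ∑[ j < n ] ∑[ k < n ] (f (i , j , k) * + 8)
    ≡⟨ sum-cong-≗ (λ i → sum-cong-≗ λ j → sum-cong-≗ λ k → indicator i j k) ⟩
  ∑[ i < n ] ∑[ j < n ] ∑[ k < n ] ([ i < j ] * [ j < k ] * cyclicity (skew M) i j k)
    ≡⟨ ∑₃-indicator (cyclicity (skew M)) ⟩
  ∑₃ (cyclicity (skew M)) ∎
  where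
  f : Fin n × Fin n × Fin n → ℤ
  f t = ⟦ does (cyclicTriple? M t) ⟧
  indicator : ∀ i j k → f (i , j , k) * + 8 ≡ [ i < j ] * [ j < k ] * cyclicity (skew M) i j k
  indicator i j k = guarded-indicator (i <? j) (j <? k)
    (does (arc? M i j) ∧ does (arc? M j k) ∧ does (arc? M k i)
      ∨ does (arc? M i k) ∧ does (arc? M k j) ∧ does (arc? M j i))
    λ i<j j<k → cyclicity-indicator (opposite M (<⇒≢ i<j)) (opposite M (<⇒≢ j<k))
      (opposite M (<⇒≢ (<-trans i<j j<k) ∘ sym))

C₃+irregularity : (M : Tournament n) → + C₃ M * + 8 + irregularity M ≡ moonConstant n
C₃+irregularity M = trans (cong (_+ irregularity M) (C₃≡∑₃ M))
  (∑₃-cyclicity (skew M) (skew-antisym M) (skew-square M))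

-- Order on ℤ

-- Transfers an inequality along an identity between the differences, which
-- can be left to the ring solver.
≤-transfer : ∀ {i j i′ j′} → j - i ≡ j′ - i′ → i′ ≤ j′ → i ≤ j
≤-transfer eq i′≤j′ = ℤ.0≤i-j⇒j≤i (subst (0ℤ ≤_) (sym eq) (ℤ.i≤j⇒0≤j-i i′≤j′))

0≤i*i : ∀ i → 0ℤ ≤ i * i
0≤i*i (+ n)    = subst (0ℤ ≤_) (ℤ.pos-* n n) (+≤+ ℕ.z≤n)
0≤i*i -[1+ n ] = +≤+ ℕ.z≤n

i*i≡0⇒i≡0 : ∀ i → i * i ≡ 0ℤ → i ≡ 0ℤ
i*i≡0⇒i≡0 i eq with ℤ.i*j≡0⇒i≡0∨j≡0 i eq
... | inj₁ i≡0 = i≡0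
... | inj₂ i≡0 = i≡0

0≤i*j : ∀ {i j} → 0ℤ ≤ i → 0ℤ ≤ j → 0ℤ ≤ i * j
0≤i*j {+ m} {+ n} _ _ = subst (0ℤ ≤_) (ℤ.pos-* m n) (+≤+ ℕ.z≤n)

*-cancelˡ-≤ : ∀ {i} j k → 0ℤ ≤ i → i ≢ 0ℤ → i * j ≤ i * k → j ≤ k
*-cancelˡ-≤ {+ zero}  j k _ i≢0 _ = contradiction refl i≢0
*-cancelˡ-≤ {+ suc n} j k _ _   = ℤ.*-cancelˡ-≤-pos j k (+ suc n)

∑-mono-≤ : {f g : Vector ℤ n} → (∀ i → f i ≤ g i) → sum f ≤ sum g
∑-mono-≤ {n = zero}  f≤g = ℤ.≤-refl
∑-mono-≤ {n = suc n} f≤g = ℤ.+-mono-≤ (f≤g zero) (∑-mono-≤ (f≤g ∘ suc))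

∑-nonneg : {f : Vector ℤ n} → (∀ i → 0ℤ ≤ f i) → 0ℤ ≤ sum f
∑-nonneg {n = n} {f} 0≤f = subst (_≤ sum f) (sum-replicate-zero n) (∑-mono-≤ 0≤f)

term≤∑ : {f : Vector ℤ n} → (∀ i → 0ℤ ≤ f i) → ∀ i → f i ≤ sum f
term≤∑ {n = suc n} {f} 0≤f i = subst (f i ≤_) (sym (sum-remove {i = i} f))
  (subst (_≤ f i + sum (f ∘ punchIn i)) (ℤ.+-identityʳ (f i)) (ℤ.+-monoʳ-≤ (f i) (∑-nonneg (0≤f ∘ punchIn i))))

∑≤0⇒≡0 : {f : Vector ℤ n} → (∀ i → 0ℤ ≤ f i) → sum f ≤ 0ℤ → ∀ i → f i ≡ 0ℤ
∑≤0⇒≡0 0≤f ∑≤0 i = ℤ.≤-antisym (ℤ.≤-trans (term≤∑ 0≤f i) ∑≤0) (0≤f i)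

0≤x·x : (x : Vector ℤ n) → 0ℤ ≤ x · x
0≤x·x x = ∑-nonneg λ i → 0≤i*i (x i)

-- Singular tournaments are irregular

module _ (M : Tournament n) (z : Vector ℤ n) (Mz≡0 : ∀ i → matrix M i · z ≡ 0ℤ) where

  private
    σ : ℤ
    σ = sum z
    d : Vector ℤ n
    d = imbalance M

  kernel-skew : ∀ i → skew M i · z ≡ z i - σ
  kernel-skew i = begin
    skew M i · z
      ≡⟨ sum-cong-≗ (λ j → trans (cong (_* z j) (skew≡2M-1+I M i j)) (expand (matrix M i j) (I n i j) (z j))) ⟩
    ∑[ j < n ] (+ 2 * (matrix M i j * z j) + I n i j * z j + - z j)
      ≡⟨ ∑-distrib-+ (λ j → + 2 * (matrix M i j * z j) + I n i j * z j) (λ j → - z j) ⟩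
    ∑[ j < n ] (+ 2 * (matrix M i j * z j) + I n i j * z j) + ∑[ j < n ] (- z j)
      ≡⟨ cong₂ _+_ (∑-distrib-+ (λ j → + 2 * (matrix M i j * z j)) (λ j → I n i j * z j)) (∑-neg z) ⟩
    ∑[ j < n ] (+ 2 * (matrix M i j * z j)) + I n i · z - σ
      ≡⟨ cong₂ (λ s t → s + t - σ) (trans (sym (*-distribˡ-sum (+ 2) (λ j → matrix M i j * z j))) (cong (_*_ (+ 2)) (Mz≡0 i))) (I-· i z) ⟩
    0ℤ + z i - σ
      ≡⟨ cong (_- σ) (ℤ.+-identityˡ (z i)) ⟩
    z i - σ ∎
    where
    expand : ∀ a e z → (+ 2 * a - 1ℤ + e) * z ≡ + 2 * (a * z) + e * z + - z
    expand = solve-∀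

  -- Pair `kernel-skew` with `z`: the quadratic form of an antisymmetric matrix vanishes.
  kernel-norm : z · z ≡ σ * σ
  kernel-norm = ℤ.i-j≡0⇒i≡j (z · z) (σ * σ) (begin
    z · z - σ * σ
      ≡⟨ cong (λ t → z · z - t) (*-distribʳ-sum σ z) ⟩
    z · z - ∑[ i < n ] (z i * σ)
      ≡⟨ cong (_+_ (z · z)) (∑-neg (λ i → z i * σ)) ⟨
    z · z + ∑[ i < n ] (- (z i * σ))
      ≡⟨ ∑-distrib-+ (λ i → z i * z i) (λ i → - (z i * σ)) ⟨
    ∑[ i < n ] (z i * z i + - (z i * σ))
      ≡⟨ sum-cong-≗ (λ i → trans (factor (z i) σ) (cong (z i *_) (sym (kernel-skew i)))) ⟩
    ∑[ i < n ] (z i * (skew M i · z))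
      ≡⟨ sum-cong-≗ (λ i → *-distribˡ-sum (z i) (λ j → skew M i j * z j)) ⟩
    ∑[ i < n ] ∑[ j < n ] (z i * (skew M i j * z j))
      ≡⟨ ∑∑-antisym (λ i j → z i * (skew M i j * z j)) antisym ⟩
    0ℤ ∎)
    where
    factor : ∀ z σ → z * z + - (z * σ) ≡ z * (z - σ)
    factor = solve-∀
    flip : ∀ a s b → a * ((- s) * b) ≡ - (b * (s * a))
    flip = solve-∀
    antisym : ∀ i j → z i * (skew M i j * z j) ≡ - (z j * (skew M j i * z i))
    antisym i j = trans (cong (λ s → z i * (s * z j)) (skew-antisym M i j)) (flip (z i) (skew M j i) (z j))

  -- Since d = S 1 and S is antisymmetric, d · z is minus the sum of the entries of S z, which
  -- `kernel-skew` gives.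
  kernel-imbalance : d · z ≡ (+ n - 1ℤ) * σ
  kernel-imbalance = begin
    d · z
      ≡⟨ sum-cong-≗ (λ i → *-distribʳ-sum (z i) (skew M i)) ⟩
    ∑[ i < n ] ∑[ j < n ] (skew M i j * z i)
      ≡⟨ ∑-comm (λ i j → skew M i j * z i) ⟩
    ∑[ j < n ] ∑[ i < n ] (skew M i j * z i)
      ≡⟨ sum-cong-≗ (λ j → trans (sum-cong-≗ λ i → trans (cong (_* z i) (skew-antisym M i j)) (sym (ℤ.neg-distribˡ-* (skew M j i) (z i))))
           (trans (∑-neg (λ i → skew M j i * z i)) (cong -_ (kernel-skew j)))) ⟩
    ∑[ j < n ] (- (z j - σ))
      ≡⟨ sum-cong-≗ (λ j → expand (z j) σ) ⟩
    ∑[ j < n ] (1ℤ * σ + - z j)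
      ≡⟨ ∑-distrib-+ (λ j → 1ℤ * σ) (λ j → - z j) ⟩
    ∑[ j < n ] (1ℤ * σ) + ∑[ j < n ] (- z j)
      ≡⟨ cong₂ _+_ (trans (sym (*-distribʳ-sum {n} σ ones)) (cong (_* σ) (∑-ones n))) (∑-neg z) ⟩
    + n * σ - σ
      ≡⟨ collect (+ n) σ ⟩
    (+ n - 1ℤ) * σ ∎
    where
    expand : ∀ z σ → - (z - σ) ≡ 1ℤ * σ + - z
    expand = solve-∀
    collect : ∀ n σ → n * σ - σ ≡ (n - 1ℤ) * σ
    collect = solve-∀

-- The square norm of σ d - (n - 1) z is σ² (∑ d² - (n - 1)²).
singular⇒irregular : (M : Tournament n) → Singular M → (+ n - 1ℤ) * (+ n - 1ℤ) ≤ irregularity M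
singular⇒irregular {n} M detM≡0 with det≡0⇒kernel (matrix M) detM≡0
... | z , (p , zₚ≢0) , Mz≡0 = *-cancelˡ-≤ (k * k) (d · d) (0≤i*i σ) σ²≢0 (≤-transfer (sym norm) (0≤x·x w))
  where
  σ k : ℤ
  σ = sum z
  k = + n - 1ℤ
  d w : Vector ℤ n
  d = imbalance M
  w i = σ * d i + (- k) * z i
  -- A kernel vector with sum 0 would have square norm 0 by `kernel-norm`.
  σ²≢0 : σ * σ ≢ 0ℤ
  σ²≢0 σ²≡0 = zₚ≢0 (i*i≡0⇒i≡0 (z p)
    (∑≤0⇒≡0 (λ i → 0≤i*i (z i)) (ℤ.≤-reflexive (trans (kernel-norm M z Mz≡0) σ²≡0)) p))
  simplify : ∀ σ k D → σ * σ * D + + 2 * σ * (- k) * (k * σ) + (- k) * (- k) * (σ * σ) - 0ℤ ≡ σ * σ * D - σ * σ * (k * k)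
  simplify = solve-∀
  norm : w · w - 0ℤ ≡ σ * σ * (d · d) - σ * σ * (k * k)
  norm = begin
    w · w - 0ℤ
      ≡⟨ cong (_- 0ℤ) (combination-square σ (- k) d z) ⟩
    σ * σ * (d · d) + + 2 * σ * (- k) * (d · z) + (- k) * (- k) * (z · z) - 0ℤ
      ≡⟨ cong₂ (λ s t → σ * σ * (d · d) + + 2 * σ * (- k) * s + (- k) * (- k) * t - 0ℤ)
           (kernel-imbalance M z Mz≡0) (kernel-norm M z Mz≡0) ⟩
    σ * σ * (d · d) + + 2 * σ * (- k) * (k * σ) + (- k) * (- k) * (σ * σ) - 0ℤ
      ≡⟨ simplify σ k (d · d) ⟩
    σ * σ * (d · d) - σ * σ * (k * k) ∎

fewer-triples⇒irregular : (M N : Tournament n) → C₃ N ℕ.≤ C₃ M → irregularity M ≤ irregularity N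
fewer-triples⇒irregular {n} M N C₃N≤C₃M = ≤-transfer difference (ℤ.*-monoʳ-≤-nonNeg (+ 8) (+≤+ C₃N≤C₃M))
  where
  exchange : ∀ a b x y → y - x ≡ (b + y) - (a + x) + (a - b)
  exchange = solve-∀
  cancel : ∀ c d → c - c + d ≡ d
  cancel = solve-∀
  difference : irregularity N - irregularity M ≡ + C₃ M * + 8 - + C₃ N * + 8
  difference = begin
    irregularity N - irregularity M
      ≡⟨ exchange (+ C₃ M * + 8) (+ C₃ N * + 8) (irregularity M) (irregularity N) ⟩
    (+ C₃ N * + 8 + irregularity N) - (+ C₃ M * + 8 + irregularity M) + (+ C₃ M * + 8 - + C₃ N * + 8)
      ≡⟨ cong₂ (λ s t → s - t + (+ C₃ M * + 8 - + C₃ N * + 8)) (C₃+irregularity N) (C₃+irregularity M) ⟩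
    moonConstant n - moonConstant n + (+ C₃ M * + 8 - + C₃ N * + 8)
      ≡⟨ cancel (moonConstant n) (+ C₃ M * + 8 - + C₃ N * + 8) ⟩
    + C₃ M * + 8 - + C₃ N * + 8 ∎

-- Cuts

-- The sign covers both directions: 1 if all crossing arcs leave the part `p`, -1 if all of them
-- enter it.
Cut : Tournament n → (Fin n → Bool) → ℤ → Set
Cut M p ε = ∀ i j → p i ≡ true → p j ≡ false → skew M i j ≡ ε

size : (Fin n → Bool) → ℤ
size {n} p = ∑[ i < n ] ⟦ p i ⟧

size-complement : (p : Fin n → Bool) → size (not ∘ p) ≡ + n - size p
size-complement {n} p = begin
  ∑[ i < n ] ⟦ not (p i) ⟧              ≡⟨ sum-cong-≗ (λ i → ⟦not⟧ (p i)) ⟩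
  ∑[ i < n ] (1ℤ + - ⟦ p i ⟧)           ≡⟨ ∑-distrib-+ {n} ones (λ i → - ⟦ p i ⟧) ⟩
  ∑[ i < n ] 1ℤ + ∑[ i < n ] (- ⟦ p i ⟧) ≡⟨ cong₂ _+_ (∑-ones n) (∑-neg (λ i → ⟦ p i ⟧)) ⟩
  + n - size p                          ∎
  where
  ⟦not⟧ : ∀ b → ⟦ not b ⟧ ≡ 1ℤ + - ⟦ b ⟧
  ⟦not⟧ true  = refl
  ⟦not⟧ false = refl

0≤⟦⟧ : ∀ b → 0ℤ ≤ ⟦ b ⟧
0≤⟦⟧ true  = +≤+ ℕ.z≤n
0≤⟦⟧ false = ℤ.≤-refl

1≤size : (p : Fin n → Bool) (i : Fin n) → p i ≡ true → 1ℤ ≤ size p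
1≤size p i pᵢ = subst (_≤ size p) (cong ⟦_⟧ pᵢ) (term≤∑ (λ k → 0≤⟦⟧ (p k)) i)

module _ (M : Tournament n) (p : Fin n → Bool) {ε : ℤ} (ε*ε≡1 : ε * ε ≡ 1ℤ) (cut : Cut M p ε) where

  private
    χ d : Vector ℤ n
    χ i = ⟦ p i ⟧
    d = imbalance M
    b N : ℤ
    b = size p
    N = + n

  -- Arcs inside the part cancel in pairs, and each of the b (N - b) crossing arcs counts `ε`.
  cut-imbalance : d · χ ≡ ε * (b * (N - b))
  cut-imbalance = begin
    d · χ
      ≡⟨ sum-cong-≗ (λ i → *-distribʳ-sum (χ i) (skew M i)) ⟩
    ∑[ i < n ] ∑[ j < n ] (skew M i j * χ i)
      ≡⟨ sum-cong-≗ (λ i → trans (sum-cong-≗ (split i)) (∑-distrib-+ (inner i) (outer i))) ⟩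
    ∑[ i < n ] (sum (inner i) + sum (outer i))
      ≡⟨ ∑-distrib-+ (λ i → sum (inner i)) (λ i → sum (outer i)) ⟩
    ∑[ i < n ] sum (inner i) + ∑[ i < n ] sum (outer i)
      ≡⟨ cong₂ _+_ (∑∑-antisym inner inner-antisym) (sum-cong-≗ outer-sum) ⟩
    0ℤ + ∑[ i < n ] (χ i * (ε * (N - b)))
      ≡⟨ ℤ.+-identityˡ _ ⟩
    ∑[ i < n ] (χ i * (ε * (N - b)))
      ≡⟨ *-distribʳ-sum (ε * (N - b)) χ ⟨
    b * (ε * (N - b))
      ≡⟨ exchange b ε (N - b) ⟩
    ε * (b * (N - b)) ∎
    where
    exchange : ∀ a b c → a * (b * c) ≡ b * (a * c)
    exchange = solve-∀
    inner outer : Fin n → Fin n → ℤ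
    inner i j = skew M i j * (χ i * χ j)
    outer i j = χ i * ε * (1ℤ + - χ j)
    flip : ∀ s a b → (- s) * (a * b) ≡ - (s * (b * a))
    flip = solve-∀
    inner-antisym : ∀ i j → inner i j ≡ - inner j i
    inner-antisym i j = trans (cong (_* (χ i * χ j)) (skew-antisym M i j)) (flip (skew M j i) (χ i) (χ j))
    outer-sum : ∀ i → sum (outer i) ≡ χ i * (ε * (N - b))
    outer-sum i = begin
      ∑[ j < n ] (χ i * ε * (1ℤ + - χ j))      ≡⟨ *-distribˡ-sum (χ i * ε) (λ j → 1ℤ + - χ j) ⟨
      χ i * ε * (∑[ j < n ] (1ℤ + - χ j))      ≡⟨ cong (χ i * ε *_) (∑-distrib-+ {n} ones (λ j → - χ j)) ⟩
      χ i * ε * (∑[ j < n ] 1ℤ + ∑[ j < n ] (- χ j)) ≡⟨ cong (χ i * ε *_) (cong₂ _+_ (∑-ones n) (∑-neg χ)) ⟩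
      χ i * ε * (N - b)                        ≡⟨ ℤ.*-assoc (χ i) ε (N - b) ⟩
      χ i * (ε * (N - b))                      ∎
    split : ∀ i j → skew M i j * χ i ≡ inner i j + outer i j
    split i j with p i in pᵢ | p j in pⱼ
    ... | true  | true  = in-in (skew M i j) ε
      where
      in-in : ∀ s ε → s * 1ℤ ≡ s * (1ℤ * 1ℤ) + 1ℤ * ε * 0ℤ
      in-in = solve-∀
    ... | true  | false = trans (cong (_* 1ℤ) (cut i j pᵢ pⱼ)) (in-out (skew M i j) ε)
      where
      in-out : ∀ s ε → ε * 1ℤ ≡ s * 0ℤ + 1ℤ * ε * 1ℤ
      in-out = solve-∀
    ... | false | b     = out (skew M i j) ε ⟦ b ⟧
      where
      out : ∀ s ε c → s * 0ℤ ≡ s * (0ℤ * c) + 0ℤ * ε * (1ℤ + - c)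
      out = solve-∀

  χ·χ : χ · χ ≡ b
  χ·χ = sum-cong-≗ λ i → idempotent (p i)
    where
    idempotent : ∀ c → ⟦ c ⟧ * ⟦ c ⟧ ≡ ⟦ c ⟧
    idempotent true  = refl
    idempotent false = refl

  -- Cauchy–Schwarz for d and the centred indicator y.
  cut-irregularity : N * (b * (N - b)) ≤ irregularity M
  cut-irregularity = ≤-transfer (sym norm) (0≤x·x w)
    where
    y w : Vector ℤ n
    y i = N * χ i - b * 1ℤ
    -- Here d · y = ε (y · y), so `w` is the component of `d` orthogonal to `y`, and its norm is D -
    -- y · y. The factor `N` in `y` keeps the centring integral.
    w i = 1ℤ * d i + (- ε) * y i
    d·y : d · y ≡ N * (ε * (b * (N - b)))
    d·y = begin
      d · y                          ≡⟨ ·-linear d χ ones N b ⟩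
      N * (d · χ) - b * (d · ones)   ≡⟨ cong₂ (λ s t → N * s - b * t) cut-imbalance (trans (·-ones d) (∑-imbalance M)) ⟩
      N * (ε * (b * (N - b))) - b * 0ℤ ≡⟨ drop (N * (ε * (b * (N - b)))) b ⟩
      N * (ε * (b * (N - b)))        ∎
      where
      drop : ∀ a b → a - b * 0ℤ ≡ a
      drop = solve-∀
    y·y : y · y ≡ N * (b * (N - b))
    y·y = begin
      y · y
        ≡⟨ sum-cong-≗ (λ i → cong (λ t → (N * χ i + t) * (N * χ i + t)) (ℤ.neg-distribˡ-* b 1ℤ)) ⟩
      (λ i → N * χ i + (- b) * 1ℤ) · (λ i → N * χ i + (- b) * 1ℤ)
        ≡⟨ combination-square N (- b) χ ones ⟩
      N * N * (χ · χ) + + 2 * N * (- b) * (χ · ones) + (- b) * (- b) * (ones {n} · ones)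
        ≡⟨ cong₂ (λ s t → N * N * s + + 2 * N * (- b) * (χ · ones) + (- b) * (- b) * t) χ·χ (∑-ones n) ⟩
      N * N * b + + 2 * N * (- b) * (χ · ones) + (- b) * (- b) * N
        ≡⟨ cong (λ s → N * N * b + + 2 * N * (- b) * s + (- b) * (- b) * N) (·-ones χ) ⟩
      N * N * b + + 2 * N * (- b) * b + (- b) * (- b) * N
        ≡⟨ collect N b ⟩
      N * (b * (N - b)) ∎
      where
      collect : ∀ N b → N * N * b + + 2 * N * (- b) * b + (- b) * (- b) * N ≡ N * (b * (N - b))
      collect = solve-∀
    norm : w · w - 0ℤ ≡ irregularity M - N * (b * (N - b))
    norm = begin
      w · w - 0ℤ
        ≡⟨ cong (_- 0ℤ) (combination-square 1ℤ (- ε) d y) ⟩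
      1ℤ * 1ℤ * (d · d) + + 2 * 1ℤ * (- ε) * (d · y) + (- ε) * (- ε) * (y · y) - 0ℤ
        ≡⟨ cong₂ (λ s t → 1ℤ * 1ℤ * (d · d) + + 2 * 1ℤ * (- ε) * s + (- ε) * (- ε) * t - 0ℤ) d·y y·y ⟩
      1ℤ * 1ℤ * (d · d) + + 2 * 1ℤ * (- ε) * (N * (ε * (b * (N - b)))) + (- ε) * (- ε) * (N * (b * (N - b))) - 0ℤ
        ≡⟨ collect (d · d) ε N (b * (N - b)) ⟩
      (d · d) - (ε * ε) * (N * (b * (N - b)))
        ≡⟨ cong (λ s → (d · d) - s * (N * (b * (N - b)))) ε*ε≡1 ⟩
      (d · d) - 1ℤ * (N * (b * (N - b)))
        ≡⟨ cong (_-_ (d · d)) (ℤ.*-identityˡ (N * (b * (N - b)))) ⟩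
      irregularity M - N * (b * (N - b)) ∎
      where
      collect : ∀ D ε N c → 1ℤ * 1ℤ * D + + 2 * 1ℤ * (- ε) * (N * (ε * c)) + (- ε) * (- ε) * (N * c) - 0ℤ ≡ D - (ε * ε) * (N * c)
      collect = solve-∀

-- Adding and removing vertices

module _ {N : Tournament m} {M : Tournament (suc m)} (v : Fin (suc m))
         (extends : ∀ i j → matrix M (punchIn v i) (punchIn v j) ≡ matrix N i j) where

  private
    x δ : Vector ℤ m
    x i = skew M v (punchIn v i)
    δ = imbalance N

  imbalance-new : imbalance M v ≡ sum x
  imbalance-new = begin
    imbalance M v        ≡⟨ sum-remove {i = v} (skew M v) ⟩
    skew M v v + sum x   ≡⟨ cong (_+ sum x) (ℤ.i≡j⇒i-j≡0 {matrix M v v} refl) ⟩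
    0ℤ + sum x           ≡⟨ ℤ.+-identityˡ (sum x) ⟩
    sum x                ∎

  imbalance-old : ∀ i → imbalance M (punchIn v i) ≡ δ i - x i
  imbalance-old i = begin
    imbalance M (punchIn v i)
      ≡⟨ sum-remove {i = v} (skew M (punchIn v i)) ⟩
    skew M (punchIn v i) v + ∑[ j < m ] skew M (punchIn v i) (punchIn v j)
      ≡⟨ cong₂ _+_ (skew-antisym M (punchIn v i) v) (sum-cong-≗ λ j → cong₂ _-_ (extends i j) (extends j i)) ⟩
    - x i + δ i
      ≡⟨ ℤ.+-comm (- x i) (δ i) ⟩
    δ i - x i ∎

  -- The old imbalances become `δ - x`; the final summand m is x · x, as `x` consists of signs.
  irregularity-extension : irregularity M ≡ sum x * sum x + irregularity N - + 2 * (x · δ) + + m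
  irregularity-extension = begin
    irregularity M
      ≡⟨ sum-remove {i = v} (λ i → imbalance M i * imbalance M i) ⟩
    imbalance M v * imbalance M v + ∑[ i < m ] (imbalance M (punchIn v i) * imbalance M (punchIn v i))
      ≡⟨ cong₂ _+_ (cong (λ t → t * t) imbalance-new) (sum-cong-≗ λ i → cong (λ t → t * t) (old i)) ⟩
    sum x * sum x + w · w
      ≡⟨ cong (_+_ (sum x * sum x)) (combination-square -1ℤ 1ℤ x δ) ⟩
    sum x * sum x + (-1ℤ * -1ℤ * (x · x) + + 2 * -1ℤ * 1ℤ * (x · δ) + 1ℤ * 1ℤ * (δ · δ))
      ≡⟨ cong (λ t → sum x * sum x + (-1ℤ * -1ℤ * t + + 2 * -1ℤ * 1ℤ * (x · δ) + 1ℤ * 1ℤ * (δ · δ))) x·x ⟩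
    sum x * sum x + (-1ℤ * -1ℤ * + m + + 2 * -1ℤ * 1ℤ * (x · δ) + 1ℤ * 1ℤ * (δ · δ))
      ≡⟨ collect (sum x) (+ m) (x · δ) (δ · δ) ⟩
    sum x * sum x + irregularity N - + 2 * (x · δ) + + m ∎
    where
    w : Vector ℤ m
    w i = -1ℤ * x i + 1ℤ * δ i
    rearrange : ∀ d x → d - x ≡ -1ℤ * x + 1ℤ * d
    rearrange = solve-∀
    old : ∀ i → imbalance M (punchIn v i) ≡ w i
    old i = trans (imbalance-old i) (rearrange (δ i) (x i))
    x·x : x · x ≡ + m
    x·x = trans (sum-cong-≗ λ i → skew-square M (punchInᵢ≢i v i ∘ sym)) (∑-ones m)
    collect : ∀ X N P D → X * X + (-1ℤ * -1ℤ * N + + 2 * -1ℤ * 1ℤ * P + 1ℤ * 1ℤ * D) ≡ X * X + D - + 2 * P + N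
    collect = solve-∀

  -- The mixed term is a multiple of the sum of all imbalances, which is 0. The increase is
  -- therefore the same for every `N` and for a source or a sink, so comparing extensions amounts to
  -- comparing the smaller tournaments.
  irregularity-uniform-extension : ∀ {ε} → ε * ε ≡ 1ℤ → (∀ i → x i ≡ ε) →
    irregularity M ≡ irregularity N + (+ m * + m + + m)
  irregularity-uniform-extension {ε} ε*ε≡1 x≡ε = begin
    irregularity M
      ≡⟨ irregularity-extension ⟩
    sum x * sum x + irregularity N - + 2 * (x · δ) + + m
      ≡⟨ cong₂ (λ s t → s * s + irregularity N - + 2 * t + + m) sum-x x·δ ⟩
    (ε * + m) * (ε * + m) + irregularity N - + 2 * 0ℤ + + m
      ≡⟨ regroup ε (+ m) (irregularity N) ⟩
    irregularity N + ((ε * ε) * (+ m * + m) + + m)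
      ≡⟨ cong (λ t → irregularity N + (t * (+ m * + m) + + m)) ε*ε≡1 ⟩
    irregularity N + (1ℤ * (+ m * + m) + + m)
      ≡⟨ cong (λ t → irregularity N + (t + + m)) (ℤ.*-identityˡ (+ m * + m)) ⟩
    irregularity N + (+ m * + m + + m) ∎
    where
    sum-x : sum x ≡ ε * + m
    sum-x = begin
      sum x                 ≡⟨ sum-cong-≗ (λ i → trans (x≡ε i) (sym (ℤ.*-identityʳ ε))) ⟩
      ∑[ i < m ] (ε * 1ℤ)   ≡⟨ *-distribˡ-sum {m} ε ones ⟨
      ε * (∑[ i < m ] 1ℤ)   ≡⟨ cong (ε *_) (∑-ones m) ⟩
      ε * + m               ∎
    x·δ : x · δ ≡ 0ℤ
    x·δ = begin
      x · δ                  ≡⟨ sum-cong-≗ (λ i → cong (_* δ i) (x≡ε i)) ⟩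
      ∑[ i < m ] (ε * δ i)   ≡⟨ *-distribˡ-sum ε δ ⟨
      ε * sum δ              ≡⟨ cong (ε *_) (∑-imbalance N) ⟩
      ε * 0ℤ                 ≡⟨ ℤ.*-zeroʳ ε ⟩
      0ℤ                     ∎
    regroup : ∀ ε m D → (ε * m) * (ε * m) + D - + 2 * 0ℤ + m ≡ D + ((ε * ε) * (m * m) + m)
    regroup = solve-∀

I-punchIn : (v : Fin (suc m)) (i j : Fin m) → I (suc m) (punchIn v i) (punchIn v j) ≡ I m i j
I-punchIn v i j with i ≟ j
... | yes refl = I-diagonal (punchIn v i)
... | no i≢j   = I-off-diagonal (i≢j ∘ punchIn-injective v i j)

deleteVertex : Tournament (suc m) → Fin (suc m) → Tournament m
deleteVertex M v = record
  { matrix   = λ i j → matrix M (punchIn v i) (punchIn v j)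
  ; zero-one = λ i j → zero-one M (punchIn v i) (punchIn v j)
  ; M+Mᵀ≡J-I = λ i j → trans (M+Mᵀ≡J-I M (punchIn v i) (punchIn v j)) (cong (_-_ 1ℤ) (I-punchIn v i j))
  }

module _ (N : Tournament m) (out : Fin m → Bool) where

  private
    A : Matrix (suc m)
    A zero    zero    = 0ℤ
    A zero    (suc j) = ⟦ out j ⟧
    A (suc i) zero    = ⟦ not (out i) ⟧
    A (suc i) (suc j) = matrix N i j

    ⟦⟧-zero-one : ∀ b → ⟦ b ⟧ ≡ 0ℤ ⊎ ⟦ b ⟧ ≡ 1ℤ
    ⟦⟧-zero-one true  = inj₂ refl
    ⟦⟧-zero-one false = inj₁ refl

    A-zero-one : ∀ i j → A i j ≡ 0ℤ ⊎ A i j ≡ 1ℤ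
    A-zero-one zero    zero    = inj₁ refl
    A-zero-one zero    (suc j) = ⟦⟧-zero-one (out j)
    A-zero-one (suc i) zero    = ⟦⟧-zero-one (not (out i))
    A-zero-one (suc i) (suc j) = zero-one N i j

    A+Aᵀ : ∀ i j → A i j + A j i ≡ J (suc m) i j - I (suc m) i j
    A+Aᵀ zero    zero    = refl
    A+Aᵀ zero    (suc j) with out j
    ... | true  = refl
    ... | false = refl
    A+Aᵀ (suc i) zero    with out i
    ... | true  = refl
    ... | false = refl
    A+Aᵀ (suc i) (suc j) = M+Mᵀ≡J-I N i j

  addVertex : Tournament (suc m)
  addVertex = record { matrix = A ; zero-one = A-zero-one ; M+Mᵀ≡J-I = A+Aᵀ }

-- Balanced tournaments

Balanced : Tournament n → Set
Balanced M = ∀ i → -1ℤ ≤ imbalance M i × imbalance M i ≤ 1ℤ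

-- The alternating tournament: a balanced one of each order.

±_ : Bool → ℤ
± true  = 1ℤ
± false = -1ℤ

skew-addVertex : (N : Tournament m) (out : Fin m → Bool) (i : Fin m) →
  skew (addVertex N out) zero (suc i) ≡ ± out i
skew-addVertex N out i with out i
... | true  = refl
... | false = refl

even : Fin n → Bool
even zero    = true
even (suc i) = not (even i)

-- i → j iff j - i is odd and positive or even and negative.
alternating : ∀ n → Tournament n
alternating zero    = record { matrix = λ () ; zero-one = λ () ; M+Mᵀ≡J-I = λ () }
alternating (suc n) = addVertex (alternating n) even

±-not : ∀ b → ± not b ≡ - (± b)
±-not true  = refl
±-not false = refl

parity : ℕ → ℤ
parity zero    = 0ℤ
parity (suc n) = 1ℤ - parity n

∑-±even : ∀ n → ∑[ i < n ] (± even i) ≡ parity n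
∑-±even zero    = refl
∑-±even (suc n) = cong (_+_ 1ℤ) (begin
  ∑[ i < n ] (± not (even i))  ≡⟨ sum-cong-≗ {n} (λ i → ±-not (even i)) ⟩
  ∑[ i < n ] (- (± even i))    ≡⟨ ∑-neg {n} (λ i → ± even i) ⟩
  - (∑[ i < n ] (± even i))    ≡⟨ cong -_ (∑-±even n) ⟩
  - parity n                   ∎)

-- Each new vertex shifts the old imbalances by alternating signs, so they are by turns all 0 and
-- alternately 1 and -1.
imbalance-alternating : ∀ n i → imbalance (alternating (suc n)) i ≡ parity n * ± even i
imbalance-alternating n zero = begin
  imbalance (alternating (suc n)) zero  ≡⟨ imbalance-new {N = alternating n} {alternating (suc n)} zero (λ i j → refl) ⟩
  ∑[ i < n ] skew (alternating (suc n)) zero (suc i) ≡⟨ sum-cong-≗ (skew-addVertex (alternating n) even) ⟩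
  ∑[ i < n ] (± even i)                 ≡⟨ ∑-±even n ⟩
  parity n                              ≡⟨ ℤ.*-identityʳ (parity n) ⟨
  parity n * 1ℤ                         ∎
imbalance-alternating (suc n) (suc i) = begin
  imbalance (alternating (suc (suc n))) (suc i)
    ≡⟨ imbalance-old {N = alternating (suc n)} {alternating (suc (suc n))} zero (λ i j → refl) i ⟩
  imbalance (alternating (suc n)) i - skew (alternating (suc (suc n))) zero (suc i)
    ≡⟨ cong₂ _-_ (imbalance-alternating n i) (skew-addVertex (alternating (suc n)) even i) ⟩
  parity n * ± even i - ± even i
    ≡⟨ collect (parity n) (± even i) ⟩
  (1ℤ - parity n) * - (± even i)
    ≡⟨ cong ((1ℤ - parity n) *_) (±-not (even i)) ⟨
  parity (suc n) * ± even (suc i) ∎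
  where
  collect : ∀ e s → e * s - s ≡ (1ℤ - e) * - s
  collect = solve-∀

alternating-balanced : ∀ n → Balanced (alternating n)
alternating-balanced (suc n) i rewrite imbalance-alternating n i = bounded (even i) (parity-01 n)
  where
  parity-01 : ∀ n → parity n ≡ 0ℤ ⊎ parity n ≡ 1ℤ
  parity-01 zero    = inj₁ refl
  parity-01 (suc n) with parity-01 n
  ... | inj₁ eq = inj₂ (cong (_-_ 1ℤ) eq)
  ... | inj₂ eq = inj₁ (cong (_-_ 1ℤ) eq)
  bounded : ∀ {e} b → e ≡ 0ℤ ⊎ e ≡ 1ℤ → -1ℤ ≤ e * ± b × e * ± b ≤ 1ℤ
  bounded b     (inj₁ refl) = -≤+ , +≤+ ℕ.z≤n
  bounded true  (inj₂ refl) = -≤+ , ℤ.≤-refl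
  bounded false (inj₂ refl) = ℤ.≤-refl , -≤+

-- Balance as least irregularity.

bounded-square : ∀ {i} → -1ℤ ≤ i × i ≤ 1ℤ → i * i ≤ 1ℤ
bounded-square {+ 0}           _ = +≤+ ℕ.z≤n
bounded-square {+ 1}           _ = ℤ.≤-refl
bounded-square {+ suc (suc n)} (_ , +≤+ (ℕ.s≤s ()))
bounded-square { -[1+ 0 ]}     _ = ℤ.≤-refl
bounded-square { -[1+ suc n ]} (-≤- () , _)

square≤1⇒bounded : ∀ i → i * i ≤ 1ℤ → -1ℤ ≤ i × i ≤ 1ℤ
square≤1⇒bounded (+ 0)           _ = -≤+ , +≤+ ℕ.z≤n
square≤1⇒bounded (+ 1)           _ = -≤+ , ℤ.≤-refl
square≤1⇒bounded (+ suc (suc n)) (+≤+ (ℕ.s≤s ()))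
square≤1⇒bounded -[1+ 0 ]        _ = ℤ.≤-refl , -≤+
square≤1⇒bounded -[1+ suc n ]    (+≤+ (ℕ.s≤s ()))

balanced⇒irregularity≤n : (M : Tournament n) → Balanced M → irregularity M ≤ + n
balanced⇒irregularity≤n {n} M bal = subst (irregularity M ≤_) (∑-ones n)
  (∑-mono-≤ λ i → bounded-square (bal i))

-- Only `j` = 1 or -1 is at stake: then `i` is odd, hence nonzero, and its square is at least 1.
bounded-minimal : ∀ {i j k} → i - j ≡ + 2 * k → -1ℤ ≤ j × j ≤ 1ℤ → j * j ≤ i * i
bounded-minimal {i} {+ 0} _ _ = 0≤i*i i
bounded-minimal {+ suc n}    {+ 1} _ _ = +≤+ (ℕ.s≤s ℕ.z≤n)
bounded-minimal { -[1+ n ]}  {+ 1} _ _ = +≤+ (ℕ.s≤s ℕ.z≤n)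
bounded-minimal {+ 0} {+ 1} {k} eq _ =
  contradiction (trans (sym (ℤ.abs-* (+ 2) k)) (cong ∣_∣ (sym eq))) (ℕ.even≢odd ∣ k ∣ 0)
bounded-minimal {j = + suc (suc n)} _ (_ , +≤+ (ℕ.s≤s ()))
bounded-minimal {+ suc n}    { -[1+ 0 ]} _ _ = +≤+ (ℕ.s≤s ℕ.z≤n)
bounded-minimal { -[1+ n ]}  { -[1+ 0 ]} _ _ = +≤+ (ℕ.s≤s ℕ.z≤n)
bounded-minimal {+ 0} { -[1+ 0 ]} {k} eq _ =
  contradiction (trans (sym (ℤ.abs-* (+ 2) k)) (cong ∣_∣ (sym eq))) (ℕ.even≢odd ∣ k ∣ 0)
bounded-minimal {j = -[1+ suc n ]} _ (-≤- () , _)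

-- By parity the squares for `N` are minimal vertex by vertex. A total that is no larger forces
-- equality at each vertex.
least-irregular⇒balanced : (M N : Tournament n) → Balanced N → irregularity M ≤ irregularity N → Balanced M
least-irregular⇒balanced {n} M N bal M≤N i = square≤1⇒bounded (d i)
  (subst (_≤ 1ℤ) (sym (ℤ.i-j≡0⇒i≡j (d i * d i) (e i * e i) (∑≤0⇒≡0 0≤gap ∑gap≤0 i))) (bounded-square (bal i)))
  where
  d e gap : Vector ℤ n
  d = imbalance M
  e = imbalance N
  gap i = d i * d i - e i * e i
  0≤gap : ∀ i → 0ℤ ≤ gap i
  0≤gap i = ℤ.i≤j⇒0≤j-i (bounded-minimal {d i} {e i} {+ outdegree M i - + outdegree N i} (imbalance-difference M N i i) (bal i))
  ∑gap≤0 : sum gap ≤ 0ℤ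
  ∑gap≤0 = subst (_≤ 0ℤ) (sym (trans (∑-distrib-+ (λ i → d i * d i) (λ i → - (e i * e i)))
    (cong (_+_ (d · d)) (∑-neg (λ i → e i * e i))))) (ℤ.i≤j⇒i-j≤0 M≤N)

module _ (M : Tournament n) where

  private
    d : Vector ℤ n
    d = imbalance M

  balanced⇒outdegree-gap : Balanced M → ∀ i j → outdegree M i ℕ.≤ suc (outdegree M j)
  balanced⇒outdegree-gap bal i j = ℤ.drop‿+≤+ (ℤ.*-cancelˡ-≤-pos (+ outdegree M i) (+ suc (outdegree M j)) (+ 2)
    (≤-transfer difference (ℤ.+-mono-≤ (proj₂ (bal i)) (ℤ.neg-mono-≤ (proj₁ (bal j))))))
    where
    expand : ∀ r s → + 2 * (1ℤ + s) - + 2 * r ≡ + 2 - + 2 * (r - s)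
    expand = solve-∀
    difference : + 2 * + suc (outdegree M j) - + 2 * + outdegree M i ≡ + 2 - (d i - d j)
    difference = trans (expand (+ outdegree M i) (+ outdegree M j)) (cong (_-_ (+ 2)) (sym (imbalance-difference M M i j)))

  balanced⇒regular : Balanced M → Regular M ⊎ AlmostRegular M
  balanced⇒regular bal with any? (λ i → any? (λ j → outdegree M i ℕ.≟ suc (outdegree M j)))
  ... | yes gap = inj₂ (balanced⇒outdegree-gap bal , gap)
  ... | no ¬gap = inj₁ λ i j → ℕ.≤-antisym (at-most i j) (at-most j i)
    where
    at-most : ∀ i j → outdegree M i ℕ.≤ outdegree M j
    at-most i j = ℕ.≤-pred (ℕ.≤∧≢⇒< (balanced⇒outdegree-gap bal i j) λ eq → ¬gap (i , j , eq))

  outdegree-gap⇒balanced : (∀ i j → outdegree M i ℕ.≤ suc (outdegree M j)) → Balanced M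
  outdegree-gap⇒balanced gap i = lower , upper
    where
    d-gap : ∀ i j → d i ≤ d j + + 2
    d-gap i j = ≤-transfer difference (ℤ.*-monoˡ-≤-nonNeg (+ 2) (+≤+ (gap i j)))
      where
      regroup : ∀ a b → b + + 2 - a ≡ + 2 - (a - b)
      regroup = solve-∀
      expand : ∀ r s → + 2 - + 2 * (r - s) ≡ + 2 * (1ℤ + s) - + 2 * r
      expand = solve-∀
      difference : d j + + 2 - d i ≡ + 2 * + suc (outdegree M j) - + 2 * + outdegree M i
      difference = trans (regroup (d i) (d j)) (trans (cong (_-_ (+ 2)) (imbalance-difference M M i j))
        (expand (+ outdegree M i) (+ outdegree M j)))

    -- A deviation beyond ±1 at i forces all imbalances to one side of 0.
    upper : d i ≤ 1ℤ
    upper with d i ℤ.≤? 1ℤ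
    ... | yes dᵢ≤1 = dᵢ≤1
    ... | no  dᵢ≰1 = contradiction
      (subst (_≤ 1ℤ) (sym (∑≤0⇒≡0 0≤d (ℤ.≤-reflexive (∑-imbalance M)) i)) (+≤+ ℕ.z≤n)) dᵢ≰1
      where
      0≤d : ∀ j → 0ℤ ≤ d j
      0≤d j = ≤-transfer (shift (d j)) (ℤ.≤-trans (ℤ.i<j⇒suc[i]≤j (ℤ.≰⇒> dᵢ≰1)) (d-gap i j))
        where
        shift : ∀ a → a - 0ℤ ≡ a + + 2 - + 2
        shift = solve-∀
    lower : -1ℤ ≤ d i
    lower with -1ℤ ℤ.≤? d i
    ... | yes -1≤dᵢ = -1≤dᵢ
    ... | no  -1≰dᵢ = contradiction
      (subst (-1ℤ ≤_) (sym dᵢ≡0) -≤+) -1≰dᵢ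
      where
      0≤-d : ∀ j → 0ℤ ≤ - d j
      0≤-d j = ≤-transfer (shift (d j)) (ℤ.≤-trans (d-gap j i)
        (ℤ.+-monoˡ-≤ (+ 2) (ℤ.i<j⇒i≤pred[j] (ℤ.≰⇒> -1≰dᵢ))))
        where
        shift : ∀ a → - a - 0ℤ ≡ 0ℤ - a
        shift = solve-∀
      dᵢ≡0 : d i ≡ 0ℤ
      dᵢ≡0 = ℤ.neg-injective (∑≤0⇒≡0 0≤-d
        (ℤ.≤-reflexive (trans (∑-neg d) (cong -_ (∑-imbalance M)))) i)

  regular⇒balanced : Regular M ⊎ AlmostRegular M → Balanced M
  regular⇒balanced (inj₁ regular)   = outdegree-gap⇒balanced λ i j → ℕ.≤-trans (ℕ.≤-reflexive (regular i j)) (ℕ.n≤1+n _)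
  regular⇒balanced (inj₂ (gap , _)) = outdegree-gap⇒balanced gap

-- Extensions of balanced tournaments

1≤i⇒i≡+suc : ∀ {i} → 1ℤ ≤ i → ∃[ a ] i ≡ + suc a
1≤i⇒i≡+suc {+ suc a} _ = a , refl
1≤i⇒i≡+suc {+ zero} (+≤+ ())

-- With P = a + 1 and Q = b + 1 the hypotheses read 2PQ ≤ 3P + Q and 2PQ ≤ P + 3Q. If `a` or `b` is
-- 0, one of them is the claim; if both are positive, the first leaves only a = b = 1.
product-bounds⇒sum≤2 : ∀ a b → 2 ℕ.* (a ℕ.* b) ℕ.+ b ℕ.≤ 2 ℕ.+ a → 2 ℕ.* (a ℕ.* b) ℕ.+ a ℕ.≤ 2 ℕ.+ b → a ℕ.+ b ℕ.≤ 2
product-bounds⇒sum≤2 zero    b       b≤2 _ = b≤2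
product-bounds⇒sum≤2 (suc a) zero    _ a≤2 rewrite ℕ.*-zeroʳ a | ℕ.+-identityʳ a = a≤2
product-bounds⇒sum≤2 (suc a) (suc b) h _ = subst₂ (λ a b → suc a ℕ.+ suc b ℕ.≤ 2) (sym a≡0) (sym b≡0) ℕ.≤-refl
  where
  expand : ∀ a b → 2 ℕ.* ((1 ℕ.+ a) ℕ.* (1 ℕ.+ b)) ℕ.+ (1 ℕ.+ b) ≡ (3 ℕ.+ a) ℕ.+ (a ℕ.+ (b ℕ.+ (2 ℕ.* b ℕ.+ 2 ℕ.* (a ℕ.* b))))
  expand = ℕ.solve-∀
  rest≡0 : a ℕ.+ (b ℕ.+ (2 ℕ.* b ℕ.+ 2 ℕ.* (a ℕ.* b))) ≡ 0
  rest≡0 = ℕ.n≤0⇒n≡0 (ℕ.+-cancelˡ-≤ (3 ℕ.+ a) _ 0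
    (subst₂ ℕ._≤_ (expand a b) (sym (ℕ.+-identityʳ (3 ℕ.+ a))) h))
  a≡0 : a ≡ 0
  a≡0 = ℕ.m+n≡0⇒m≡0 a rest≡0
  b≡0 : b ≡ 0
  b≡0 = ℕ.m+n≡0⇒m≡0 b (ℕ.m+n≡0⇒n≡0 a rest≡0)

module _ {N : Tournament m} {M : Tournament (suc m)} (v : Fin (suc m))
         (extends : ∀ i j → matrix M (punchIn v i) (punchIn v j) ≡ matrix N i j)
         (balanced : Balanced N) (singular : Singular M) where

  private
    x δ χ : Vector ℤ m
    x i = skew M v (punchIn v i)
    δ = imbalance N
    out : Fin m → Bool
    out i = does (x i ℤ.≟ 1ℤ)
    χ i = ⟦ out i ⟧
    P : ℤ
    P = size out

    x≡2χ-1 : ∀ i → x i ≡ + 2 * χ i - 1ℤ * 1ℤ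
    x≡2χ-1 i = from (skew-±1 M (punchInᵢ≢i v i ∘ sym))
      where
      from : ∀ {s} → s ≡ 1ℤ ⊎ s ≡ -1ℤ → s ≡ + 2 * ⟦ does (s ℤ.≟ 1ℤ) ⟧ - 1ℤ * 1ℤ
      from (inj₁ refl) = refl
      from (inj₂ refl) = refl

    sum-x : sum x ≡ + 2 * P - + m
    sum-x = begin
      sum x                                        ≡⟨ sum-cong-≗ x≡2χ-1 ⟩
      ∑[ i < m ] (+ 2 * χ i + - 1ℤ)                ≡⟨ ∑-distrib-+ (λ i → + 2 * χ i) (λ _ → - 1ℤ) ⟩
      ∑[ i < m ] (+ 2 * χ i) + ∑[ i < m ] (- 1ℤ)   ≡⟨ cong₂ _+_ (sym (*-distribˡ-sum (+ 2) χ)) (trans (∑-neg {m} ones) (cong -_ (∑-ones m))) ⟩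
      + 2 * P - + m                                ∎

    x·δ : x · δ ≡ + 2 * (δ · χ)
    x·δ = begin
      x · δ                                      ≡⟨ ·-comm x δ ⟩
      δ · x                                      ≡⟨ sum-cong-≗ (λ i → cong (δ i *_) (x≡2χ-1 i)) ⟩
      δ · (λ i → + 2 * χ i - 1ℤ * ones {m} i)    ≡⟨ ·-linear δ χ ones (+ 2) 1ℤ ⟩
      + 2 * (δ · χ) - 1ℤ * (δ · ones)            ≡⟨ cong (λ t → + 2 * (δ · χ) - 1ℤ * t) (trans (·-ones δ) (∑-imbalance N)) ⟩
      + 2 * (δ · χ) - 1ℤ * 0ℤ                    ≡⟨ ℤ.+-identityʳ (+ 2 * (δ · χ)) ⟩
      + 2 * (δ · χ)                              ∎

    -P≤δ·χ : - P ≤ δ · χ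
    -P≤δ·χ = subst (_≤ δ · χ) (∑-neg χ) (∑-mono-≤ λ i → term (out i) (balanced i))
      where
      term : ∀ {e} b → -1ℤ ≤ e × e ≤ 1ℤ → - ⟦ b ⟧ ≤ e * ⟦ b ⟧
      term {e} true  (-1≤e , _) = subst (-1ℤ ≤_) (sym (ℤ.*-identityʳ e)) -1≤e
      term {e} false _          = ℤ.≤-reflexive (sym (ℤ.*-zeroʳ e))

    -- As the imbalances sum to 0, δ · χ is minus their sum over the m - P in-neighbours, each at
    -- most 1.
    P-m≤δ·χ : P - + m ≤ δ · χ
    P-m≤δ·χ = subst₂ _≤_
      (trans (∑-distrib-+ χ (λ _ → - 1ℤ)) (cong (_+_ P) (trans (∑-neg {m} ones) (cong -_ (∑-ones m)))))
      (trans (∑-distrib-+ (λ i → δ i * χ i) (λ i → - δ i))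
        (trans (cong (_+_ (δ · χ)) (trans (∑-neg δ) (cong -_ (∑-imbalance N)))) (ℤ.+-identityʳ (δ · χ))))
      (∑-mono-≤ λ i → term (out i) (balanced i))
      where
      term : ∀ {e} b → -1ℤ ≤ e × e ≤ 1ℤ → ⟦ b ⟧ + - 1ℤ ≤ e * ⟦ b ⟧ + - e
      term {e} true  _         = ℤ.≤-reflexive (cancel e)
        where
        cancel : ∀ e → 0ℤ ≡ e * 1ℤ + - e
        cancel = solve-∀
      term {e} false (_ , e≤1) = ≤-transfer (negate e) (ℤ.neg-mono-≤ e≤1)
        where
        negate : ∀ e → e * 0ℤ + - e - -1ℤ ≡ - e - - 1ℤ
        negate = solve-∀

    -- `M` has order m + 1, so singularity gives m² ≤ D. Of the two summands m, the first bounds the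
    -- irregularity of `N` and the second comes from the extension formula.
    irregularity-bound : + m * + m ≤ (+ 2 * P - + m) * (+ 2 * P - + m) + + m - + 4 * (δ · χ) + + m
    irregularity-bound = ℤ.≤-trans
      (subst₂ _≤_ (cong (λ t → t * t) (cancel (+ m))) irregularity-M (singular⇒irregular M singular))
      (≤-transfer (swap-sides ((+ 2 * P - + m) * (+ 2 * P - + m)) (irregularity N) (+ 4 * (δ · χ)) (+ m))
        (balanced⇒irregularity≤n N balanced))
      where
      cancel : ∀ m → 1ℤ + m - 1ℤ ≡ m
      cancel = solve-∀
      swap-sides : ∀ X D Q m → X + m - Q + m - (X + D - Q + m) ≡ m - D
      swap-sides = solve-∀
      double : ∀ q → + 2 * (+ 2 * q) ≡ + 4 * q
      double = solve-∀
      irregularity-M : irregularity M ≡ (+ 2 * P - + m) * (+ 2 * P - + m) + irregularity N - + 4 * (δ · χ) + + m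
      irregularity-M = trans (irregularity-extension {N = N} {M} v extends)
        (cong₂ (λ s t → s * s + irregularity N - t + + m) sum-x (trans (cong (_*_ (+ 2)) x·δ) (double (δ · χ))))

    -- With P out-neighbours and Q = m - P in-neighbours of v, a lower bound
    -- -R for δ · χ turns irregularity-bound into 4PQ ≤ 2m + 4R.
    product-bound : ∀ {R Q} → - R ≤ δ · χ → + m ≡ P + Q → + 2 * (P * Q) ≤ P + Q + + 2 * R
    product-bound {R} {Q} -R≤δ·χ m≡P+Q = ℤ.*-cancelˡ-≤-pos (+ 2 * (P * Q)) (P + Q + + 2 * R) (+ 2)
      (≤-transfer (combine P Q R (δ · χ)) (ℤ.+-mono-≤ bound (ℤ.*-monoˡ-≤-nonNeg (+ 4) -R≤δ·χ)))
      where
      bound : (P + Q) * (P + Q) ≤ (+ 2 * P - (P + Q)) * (+ 2 * P - (P + Q)) + (P + Q) - + 4 * (δ · χ) + (P + Q)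
      bound = subst (λ m → m * m ≤ (+ 2 * P - m) * (+ 2 * P - m) + m - + 4 * (δ · χ) + m) m≡P+Q irregularity-bound
      combine : ∀ P Q R S → + 2 * (P + Q + + 2 * R) - + 2 * (+ 2 * (P * Q)) ≡
        (+ 2 * P - (P + Q)) * (+ 2 * P - (P + Q)) + (P + Q) - + 4 * S + (P + Q) + + 4 * S - ((P + Q) * (P + Q) + + 4 * (- R))
      combine = solve-∀

  -- Both lower bounds on δ · χ are needed: for Q = 1 the one by -P restricts nothing, and the one
  -- by -Q then gives P ≤ 3.
  mixed-extension-small : ∀ {i j} → x i ≡ 1ℤ → x j ≡ -1ℤ → m ℕ.≤ 4
  mixed-extension-small {i} {j} xᵢ≡1 xⱼ≡-1 = subst (ℕ._≤ 4) (sym m≡) (ℕ.+-monoʳ-≤ 2 (product-bounds⇒sum≤2 a b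
    (to-ℕ a b (≤-transfer (differenceP (+ a) (+ b)) boundP)) (to-ℕ a b (≤-transfer (differenceQ (+ a) (+ b)) boundQ))))
    where
    1≤P : 1ℤ ≤ P
    1≤P = 1≤size out i (cong (λ s → does (s ℤ.≟ 1ℤ)) xᵢ≡1)
    1≤m-P : 1ℤ ≤ + m - P
    1≤m-P = subst (1ℤ ≤_) (size-complement out)
      (1≤size (not ∘ out) j (cong (λ s → not (does (s ℤ.≟ 1ℤ))) xⱼ≡-1))
    a b : ℕ
    a = proj₁ (1≤i⇒i≡+suc 1≤P)
    b = proj₁ (1≤i⇒i≡+suc 1≤m-P)
    P≡ : P ≡ + suc a
    P≡ = proj₂ (1≤i⇒i≡+suc 1≤P)
    Q≡ : + m - P ≡ + suc b
    Q≡ = proj₂ (1≤i⇒i≡+suc 1≤m-P)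
    split : ∀ m P → m ≡ P + (m - P)
    split = solve-∀
    m≡ : m ≡ 2 ℕ.+ (a ℕ.+ b)
    m≡ = trans (ℤ.+-injective (trans (split (+ m) P) (cong₂ _+_ P≡ Q≡))) (cong suc (ℕ.+-suc a b))
    boundP : + 2 * (+ suc a * + suc b) ≤ + suc a + + suc b + + 2 * + suc a
    boundP = subst₂ (λ P Q → + 2 * (P * Q) ≤ P + Q + + 2 * P) P≡ Q≡ (product-bound -P≤δ·χ (split (+ m) P))
    boundQ : + 2 * (+ suc a * + suc b) ≤ + suc a + + suc b + + 2 * + suc b
    boundQ = subst₂ (λ P Q → + 2 * (P * Q) ≤ P + Q + + 2 * Q) P≡ Q≡
      (product-bound {+ m - P} {+ m - P} (subst (_≤ δ · χ) (negate P (+ m)) P-m≤δ·χ) (split (+ m) P))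
      where
      negate : ∀ P m → P - m ≡ - (m - P)
      negate = solve-∀
    differenceP : ∀ a b → (+ 2 + a) - (+ 2 * (a * b) + b) ≡
      ((1ℤ + a) + (1ℤ + b) + + 2 * (1ℤ + a)) - + 2 * ((1ℤ + a) * (1ℤ + b))
    differenceP = solve-∀
    differenceQ : ∀ a b → (+ 2 + b) - (+ 2 * (a * b) + a) ≡
      ((1ℤ + a) + (1ℤ + b) + + 2 * (1ℤ + b)) - + 2 * ((1ℤ + a) * (1ℤ + b))
    differenceQ = solve-∀
    to-ℕ : ∀ a b {c d} → + 2 * (+ a * + b) + + c ≤ + 2 + + d → 2 ℕ.* (a ℕ.* b) ℕ.+ c ℕ.≤ 2 ℕ.+ d
    to-ℕ a b {c} {d} h = ℤ.drop‿+≤+ (subst (λ t → t + + c ≤ + 2 + + d)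
      (trans (cong (_*_ (+ 2)) (sym (ℤ.pos-* a b))) (sym (ℤ.pos-* 2 (a ℕ.* b)))) h)

-- Reachability

module _ {R : Fin n → Fin n → Set} (R? : ∀ i j → Dec (R i j)) (i : Fin n) where

  private
    -- Each round spends one unit of fuel and adds a vertex, so fuel plus size stays above n. The
    -- size never exceeds n, hence the fuel cannot run out before the set is closed.
    grow : (fuel : ℕ) (S : Subset n) → n ℕ.< fuel ℕ.+ Subset.∣ S ∣ → i ∈ S → (∀ {j} → j ∈ S → Star R i j) →
      ∃[ T ] i ∈ T × (∀ {j} → j ∈ T → Star R i j) × (∀ {j k} → j ∈ T → R j k → k ∈ T)
    grow zero       S n<∣S∣ _ _ = contradiction (Subset.∣p∣≤n S) (ℕ.<⇒≱ n<∣S∣)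
    grow (suc fuel) S n<f+∣S∣ i∈S reach
      with any? (λ j → any? (λ k → (j Subset.∈? S) ×-dec ¬? (k Subset.∈? S) ×-dec R? j k))
    ... | no ¬exit = S , i∈S , reach , closed
      where
      closed : ∀ {j k} → j ∈ S → R j k → k ∈ S
      closed {j} {k} j∈S Rjk with k Subset.∈? S
      ... | yes k∈S = k∈S
      ... | no  k∉S = contradiction (j , k , j∈S , k∉S , Rjk) ¬exit
    ... | yes (j , k , j∈S , k∉S , Rjk) = grow fuel (S ∪ ⁅ k ⁆)
      (ℕ.≤-trans n<f+∣S∣ (ℕ.≤-trans (ℕ.≤-reflexive (sym (ℕ.+-suc fuel Subset.∣ S ∣)))
        (ℕ.+-monoʳ-≤ fuel (Subset.p⊂q⇒∣p∣<∣q∣ (Subset.p⊆p∪q ⁅ k ⁆ , k , Subset.q⊆p∪q S ⁅ k ⁆ (Subset.x∈⁅x⁆ k) , k∉S)))))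
      (Subset.p⊆p∪q ⁅ k ⁆ i∈S) reach′
      where
      reach′ : ∀ {l} → l ∈ S ∪ ⁅ k ⁆ → Star R i l
      reach′ {l} l∈ with Subset.x∈p∪q⁻ S ⁅ k ⁆ l∈
      ... | inj₁ l∈S   = reach l∈S
      ... | inj₂ l∈⁅k⁆ = subst (Star R i) (sym (Subset.x∈⁅y⁆⇒x≡y k l∈⁅k⁆)) (reach j∈S ◅◅ (Rjk ◅ nil))

  reachableSet : ∃[ T ] i ∈ T × (∀ {j} → j ∈ T → Star R i j) × (∀ {j k} → j ∈ T → R j k → k ∈ T)
  reachableSet = grow (suc n) ⁅ i ⁆ (ℕ.m≤m+n (suc n) Subset.∣ ⁅ i ⁆ ∣) (Subset.x∈⁅x⁆ i)
    λ j∈⁅i⁆ → subst (Star R i) (sym (Subset.x∈⁅y⁆⇒x≡y i j∈⁅i⁆)) nil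

-- No arc leaves the set of vertices reachable from `i`. If `j` is outside, every crossing arc
-- enters that set, whence the sign -1.
reachable-or-cut : (M : Tournament n) (i j : Fin n) →
  Star (Arc M) i j ⊎ ∃[ p ] Cut M p -1ℤ × p i ≡ true × p j ≡ false
reachable-or-cut {n} M i j with reachableSet (arc? M) i
... | T , i∈T , reach , closed with lookup T j in Tⱼ
...   | true  = inj₁ (reach (lookup⇒[]= j T Tⱼ))
...   | false = inj₂ (lookup T , cut , []=⇒lookup i∈T , Tⱼ)
  where
  cut : Cut M (lookup T) -1ℤ
  cut k l Tₖ Tₗ = from (opposite M {k} {l} λ { refl → contradiction (trans (sym Tₖ) Tₗ) λ () })
    where
    from : Opposite (matrix M k l) (matrix M l k) → skew M k l ≡ -1ℤ
    from (inj₁ (arc , _))   = contradiction (trans (sym ([]=⇒lookup (closed (lookup⇒[]= k T Tₖ) arc))) Tₗ) λ ()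
    from (inj₂ (a≡0 , b≡1)) = cong₂ _-_ a≡0 b≡1

Star-first : ∀ {A : Set} {R : A → A → Set} {i j} → Star R i j → i ≢ j → ∃[ k ] R i k
Star-first nil       i≢i = contradiction refl i≢i
Star-first (Rik ◅ _) _   = _ , Rik

Star-last : ∀ {n} {R : Fin n → Fin n → Set} {i j} → Star R i j → i ≢ j → ∃[ k ] R k j
Star-last nil i≢i = contradiction refl i≢i
Star-last {j = j} (_◅_ {i} {k} Rik k⋆j) i≢j with k ≟ j
... | yes refl = i , Rik
... | no  k≢j  = Star-last k⋆j k≢j

-- Singular maximizers

complement-cut : (M : Tournament n) {p : Fin n → Bool} {ε : ℤ} → Cut M p ε → Cut M (not ∘ p) (- ε)
complement-cut M {p} cut i j ¬pᵢ ¬pⱼ = trans (skew-antisym M i j) (cong -_ (cut j i (not-false ¬pⱼ) (not-true ¬pᵢ)))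
  where
  not-true : ∀ {b} → not b ≡ true → b ≡ false
  not-true {false} _ = refl
  not-false : ∀ {b} → not b ≡ false → b ≡ true
  not-false {true} _ = refl

singleton-cut : (M : Tournament (suc m)) {p : Fin (suc m) → Bool} {ε : ℤ} (v : Fin (suc m)) →
  Cut M p ε → p v ≡ true → size p ≡ 1ℤ → ∀ k → skew M v (punchIn v k) ≡ ε
singleton-cut {m} M {p} v cut pᵥ size≡1 k = cut v (punchIn v k) pᵥ
  (⟦⟧≡0 (∑≤0⇒≡0 (λ k → 0≤⟦⟧ (p (punchIn v k))) (ℤ.≤-reflexive rest≡0) k))
  where
  ⟦⟧≡0 : ∀ {b} → ⟦ b ⟧ ≡ 0ℤ → b ≡ false
  ⟦⟧≡0 {false} _ = refl
  rest≡0 : ∑[ k < m ] ⟦ p (punchIn v k) ⟧ ≡ 0ℤ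
  rest≡0 = ∙-cancelˡ 1ℤ _ _ (trans (cong (λ b → ⟦ b ⟧ + ∑[ k < m ] ⟦ p (punchIn v k) ⟧) (sym pᵥ))
    (trans (sym (sum-remove {i = v} (λ i → ⟦ p i ⟧))) size≡1))

sink : Tournament m → Tournament (suc m)
sink N = addVertex N λ _ → false

sink-singular : (N : Tournament m) → Singular (sink N)
sink-singular {m} N = ∑-zero term
  where
  term : ∀ j → -1ℤ ^ toℕ j * matrix (sink N) zero j * det (minor (matrix (sink N)) zero j) ≡ 0ℤ
  term j = cong (_* det (minor (matrix (sink N)) zero j))
    (trans (cong (-1ℤ ^ toℕ j *_) (row j)) (ℤ.*-zeroʳ (-1ℤ ^ toℕ j)))
    where
    row : ∀ j → matrix (sink N) zero j ≡ 0ℤ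
    row zero    = refl
    row (suc j) = refl

module _ (M : Tournament (suc m)) (maximizer : SingularMaximizer M) where

  -- The competitor is a sink over the alternating tournament: its zero row makes it singular, and
  -- by Moon's identity a maximizer cannot be more irregular.
  maximizer-irregularity : irregularity M ≤ irregularity (alternating m) + (+ m * + m + + m)
  maximizer-irregularity = subst (irregularity M ≤_)
    (irregularity-uniform-extension {N = alternating m} {sink (alternating m)} zero (λ _ _ → refl) { -1ℤ} refl (λ _ → refl))
    (fewer-triples⇒irregular M (sink (alternating m))
      (proj₂ maximizer (sink (alternating m)) (sink-singular (alternating m))))

  -- A source or sink costs m² + m in `M` as in the competitor. Cancelling this, what remains of `M`
  -- is no more irregular than a balanced tournament, hence balanced.
  uniform⇒trivial : ∀ {ε} → ε * ε ≡ 1ℤ → (v : Fin (suc m)) → (∀ k → skew M v (punchIn v k) ≡ ε) → Trivial M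
  uniform⇒trivial ε*ε≡1 v uniform = trivial N
    (balanced⇒regular N (least-irregular⇒balanced N (alternating m) (alternating-balanced m) N≤alternating))
    (v , λ _ _ → refl)
    where
    N : Tournament m
    N = deleteVertex M v
    N≤alternating : irregularity N ≤ irregularity (alternating m)
    N≤alternating = ≤-transfer (shift (irregularity N) (irregularity (alternating m)) (+ m * + m + + m))
      (subst (_≤ irregularity (alternating m) + (+ m * + m + + m))
        (irregularity-uniform-extension {N = N} {M} v (λ _ _ → refl) ε*ε≡1 uniform) maximizer-irregularity)
      where
      shift : ∀ a b c → b - a ≡ (b + c) - (a + c)
      shift = solve-∀

  -- The bound n b (n - b) ≤ n² - 1 leaves no room for (b - 1) (n - b - 1) > 0.
  cut-product : ∀ {p i j} → Cut M p -1ℤ → p i ≡ true → p j ≡ false →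
    (size p - 1ℤ) * (+ suc m - size p - 1ℤ) ≡ 0ℤ
  cut-product {p} {i} {j} cut pᵢ pⱼ = ℤ.≤-antisym (ℤ.i<j⇒i≤pred[j] product<1) 0≤product
    where
    b product : ℤ
    b = size p
    product = (b - 1ℤ) * (+ suc m - b - 1ℤ)
    0≤product : 0ℤ ≤ product
    0≤product = 0≤i*j (ℤ.i≤j⇒0≤j-i (1≤size p i pᵢ))
      (ℤ.i≤j⇒0≤j-i (subst (1ℤ ≤_) (size-complement p) (1≤size (not ∘ p) j (cong not pⱼ))))
    bound : + suc m * (b * (+ suc m - b)) ≤ + m + (+ m * + m + + m)
    bound = ℤ.≤-trans (cut-irregularity M p { -1ℤ} refl cut) (ℤ.≤-trans maximizer-irregularity
      (ℤ.+-monoˡ-≤ (+ m * + m + + m) (balanced⇒irregularity≤n (alternating m) (alternating-balanced m))))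
    -- With n = 1 + m, b (n - b) = (b - 1)(n - b - 1) + m. Subtracting n m from m² + 2m = n² - 1
    -- leaves m, which is less than n.
    regroup : ∀ m b → m - (1ℤ + m) * ((b - 1ℤ) * ((1ℤ + m) - b - 1ℤ)) ≡ (m + (m * m + m)) - (1ℤ + m) * (b * ((1ℤ + m) - b))
    regroup = solve-∀
    n*product≤m : + suc m * product ≤ + m
    n*product≤m = ≤-transfer (regroup (+ m) b) bound
    product<1 : product < 1ℤ
    product<1 = ℤ.*-cancelˡ-<-nonNeg {product} {1ℤ} (+ suc m)
      (ℤ.≤-<-trans n*product≤m (subst (+ m <_) (sym (ℤ.*-identityʳ (+ suc m))) (+<+ (ℕ.n<1+n m))))

  cut⇒trivial : ∀ {p i j} → Cut M p -1ℤ → p i ≡ true → p j ≡ false → Trivial M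
  cut⇒trivial {p} {i} {j} cut pᵢ pⱼ = from (ℤ.i*j≡0⇒i≡0∨j≡0 (size p - 1ℤ) (cut-product {p} cut pᵢ pⱼ))
    where
    from : size p - 1ℤ ≡ 0ℤ ⊎ + suc m - size p - 1ℤ ≡ 0ℤ → Trivial M
    from (inj₁ b-1≡0)   = uniform⇒trivial { -1ℤ} refl i
      (singleton-cut M {p} i cut pᵢ (ℤ.i-j≡0⇒i≡j (size p) 1ℤ b-1≡0))
    -- Now the complement is a single vertex; seen from there the sign is reversed, so `j` is a
    -- source.
    from (inj₂ n-b-1≡0) = uniform⇒trivial {1ℤ} refl j
      (singleton-cut M {not ∘ p} j (complement-cut M {p} cut) (cong not pⱼ)
        (trans (size-complement p) (ℤ.i-j≡0⇒i≡j (+ suc m - size p) 1ℤ n-b-1≡0)))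

arc⇒≢ : (M : Tournament n) {i j : Fin n} → Arc M i j → i ≢ j
arc⇒≢ M {i} arc refl = contradiction (trans (sym (ℤ.i≡j⇒i-j≡0 {matrix M i i} refl)) (arc⇒skew M arc)) λ ()

-- A walk from `v` to another vertex begins with an arc out of `v`, and a walk back ends with an arc
-- into `v`. The extension is then mixed, which bounds m by 4.
trivial⇒¬stronglyConnected : n ≥ 7 → (M : Tournament n) → Singular M → Trivial M → ¬ StronglyConnected M
trivial⇒¬stronglyConnected (ℕ.s≤s 6≤m@(ℕ.s≤s _)) M singular (trivial {m} N regular (v , extends)) connected =
  ℕ.<⇒≱ (ℕ.≤-trans (ℕ.n≤1+n 5) 6≤m)
    (mixed-extension-small {N = N} {M} v extends (regular⇒balanced N regular) singular x≡1 x≡-1)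
  where
  w : Fin (suc m)
  w = punchIn v zero
  successor : ∃[ k ] Arc M v k
  successor = Star-first (connected v w) (punchInᵢ≢i v zero ∘ sym)
  predecessor : ∃[ k ] Arc M k v
  predecessor = Star-last (connected w v) (punchInᵢ≢i v zero)
  v≢successor : v ≢ proj₁ successor
  v≢successor = arc⇒≢ M (proj₂ successor)
  v≢predecessor : v ≢ proj₁ predecessor
  v≢predecessor = arc⇒≢ M (proj₂ predecessor) ∘ sym
  x≡1 : skew M v (punchIn v (punchOut v≢successor)) ≡ 1ℤ
  x≡1 = trans (cong (skew M v) (punchIn-punchOut v≢successor)) (arc⇒skew M (proj₂ successor))
  x≡-1 : skew M v (punchIn v (punchOut v≢predecessor)) ≡ -1ℤ
  x≡-1 = trans (cong (skew M v) (punchIn-punchOut v≢predecessor))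
    (trans (skew-antisym M v (proj₁ predecessor)) (cong -_ (arc⇒skew M (proj₂ predecessor))))

nontrivial⇒stronglyConnected : (M : Tournament n) → SingularMaximizer M → Nontrivial M → StronglyConnected M
nontrivial⇒stronglyConnected {suc m} M maximizer nontrivial i j with reachable-or-cut M i j
... | inj₁ path                  = path
... | inj₂ (p , cut , pᵢ , pⱼ) = contradiction (cut⇒trivial M maximizer cut pᵢ pⱼ) nontrivial

proposition2p9 : (n : ℕ) → n ≥ 7 → (M : Tournament n) → SingularMaximizer M → Nontrivial M ⇔ StronglyConnected M
proposition2p9 n n≥7 M maximizer = mk⇔
  (nontrivial⇒stronglyConnected M maximizer)
  (λ connected triv → trivial⇒¬stronglyConnected n≥7 M (proj₁ maximizer) triv connected)
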